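{- Let $r\ge 3$, $t\ge 2$ and $k\ge 2(t-1)(r-2)+2$ be integers. Then, as $n\to\infty$, $$ex_r(n,\mathbb{H}_t^rP_k)=(t-1-o(1))\binom{n}{2},\qquad ex_r(n,\mathbb{B}_t^rP_k)=(t-1-o(1))\binom{n}{2},$$ and $$ex_r(n,\mathbb{H}_t^rC_{k-1})=(t-1-o(1))\binom{n}{2},\qquad ex_r(n,\mathbb{B}_t^rC_{k-1})=(t-1-o(1))\binom{n}{2}.$$
   Context: $P_k$ denotes the path on $k$ vertices and $C_{\ell}$ the cycle on $\ell$ vertices. A hypergraph consists of a finite vertex set and a set of distinct subsets of it (hyperedges); it is $r$-uniform if all hyperedges have size $r$. For an integer $t\ge1$ and a graph $F$, a hypergraph $\mathcal{F}$ is a $t$-heavy copy of $F$ if there exist an injection $i:V(F)\to V(\mathcal{F})$ and a map $h$ assigning to each edge $e$ of $F$ a set $h(e)$ of $t$ distinct hyperedges of $\mathcal{F}$ such that for every edge $e=xy$ of $F$, $\{i(x),i(y)\}\subseteq A$ for all $A\in h(e)$. It is a $t$-wise Berge copy of $F$ if moreover $|E(\mathcal{F})|=t|E(F)|$ and such $i,h$ exist with $h(e)\cap h(e')=\emptyset$ for distinct edges $e,e'$ of $F$. $\mathbb{H}_t^rF$ and $\mathbb{B}_t^rF$ denote the families of $r$-uniform $t$-heavy copies and $r$-uniform $t$-wise Berge copies of $F$, respectively. $ex_r(n,\mathbb{F})$ is the maximum number of hyperedges in an $r$-uniform hypergraph on $n$ vertices containing no member of $\mathbb{F}$ as a subhypergraph.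 -}

module Defs where

open import Data.Nat using (ℕ; zero; suc; _+_; _*_; _∸_; _≤_; _<_)
open import Data.Nat.Properties using (_<?_)
open import Data.Nat.Combinatorics using (_C_)
open import Data.Fin using (Fin; zero; suc; toℕ; fromℕ<; inject₁)
open import Data.Fin.Subset using (Subset; _∈_; ∣_∣)
open import Data.Product using (Σ; _×_; _,_; ∃; ∃-syntax; proj₁; proj₂)
open import Relation.Nullary using (¬_; yes; no)
open import Relation.Binary.PropositionalEquality using (_≡_)
open import Function.Definitions using (Injective)

record Graph : Set where
  field
    v : ℕ
    e : ℕ
    ends : Fin e → Fin v × Fin v
open Graph public

Path : ℕ → Graph
Path zero = record { v = 0 ; e = 0 ; ends = λ () }
Path (suc m) = record { v = suc m ; e = m ; ends = λ j → inject₁ j , suc j }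

nextF : ∀ {m} → Fin (suc m) → Fin (suc m)
nextF {m} j with suc (toℕ j) <? suc m
... | yes p = fromℕ< p
... | no _ = zero

-- Cycle C_l: vertices 0..l-1, edges {j, j+1 mod l}  (used for l ≥ 3).
Cycle : ℕ → Graph
Cycle zero = record { v = 0 ; e = 0 ; ends = λ () }
Cycle (suc m) = record { v = suc m ; e = suc m ; ends = λ j → j , nextF j }

Uniform : (r n M : ℕ) → (Fin M → Subset n) → Set
Uniform r n M H = (∀ a → ∣ H a ∣ ≡ r) × Injective _≡_ _≡_ H

HeavyIn : (t : ℕ) (G : Graph) (n M : ℕ) → (Fin M → Subset n) → Set
HeavyIn t G n M H =
  Σ (Fin (v G) → Fin n) λ i → Injective _≡_ _≡_ i ×
  Σ (Fin (e G) → Fin t → Fin M) λ h →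
    (∀ f → Injective _≡_ _≡_ (h f)) ×
    (∀ f j → (i (proj₁ (ends G f)) ∈ H (h f j)) × (i (proj₂ (ends G f)) ∈ H (h f j)))

BergeIn : (t : ℕ) (G : Graph) (n M : ℕ) → (Fin M → Subset n) → Set
BergeIn t G n M H =
  Σ (Fin (v G) → Fin n) λ i → Injective _≡_ _≡_ i ×
  Σ (Fin (e G) → Fin t → Fin M) λ h →
    (∀ f → Injective _≡_ _≡_ (h f)) ×
    (∀ f f' j j' → h f j ≡ h f' j' → f ≡ f') ×
    (∀ f j → (i (proj₁ (ends G f)) ∈ H (h f j)) × (i (proj₂ (ends G f)) ∈ H (h f j)))

-- ex_r(n, 𝔽) = (c - o(1)) * C(n,2), written out with ε = 1/(d+1):
-- for every d there is N such that for all n ≥ N,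
--   (c - ε) C(n,2) ≤ ex_r(n,𝔽) ≤ (c + ε) C(n,2),
-- where "L ≤ ex" means some 𝔽-free r-uniform hypergraph on n vertices has ≥ L
-- hyperedges and "ex ≤ U" means every 𝔽-free one has ≤ U hyperedges.
ExAsymp : (r c : ℕ) → (Contains : (n M : ℕ) → (Fin M → Subset n) → Set) → Set
ExAsymp r c Contains =
  ∀ (d : ℕ) → ∃[ N ] ∀ n → N ≤ n →
    (∃[ M ] Σ (Fin M → Subset n) λ H → Uniform r n M H × ¬ Contains n M H ×
        ((c * suc d ∸ 1) * (n C 2) ≤ suc d * M))
    ×
    (∀ M (H : Fin M → Subset n) → Uniform r n M H → ¬ Contains n M H →
        suc d * M ≤ (c * suc d + 1) * (n C 2))

{-# OPTIONS --safe #-}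

-- Lower bound: add a core of t - 1 disjoint blocks of size r - 2 to the vertex set and complete every pair of
-- outside vertices by each block.  Every t-heavy pair then meets the core, so a t-heavy copy of a graph in which
-- each vertex lies on at most two edges has at most 2 (t - 1) (r - 2) edges.
--
-- Upper bound: let every pair of codegree d have weight 3, 1 or 0 according to d < t, t <= d < 2 t or 2 t <= d.
-- Since d times this weight is at most 3 (t - 1), at most (t - 1) (n choose 2) hyperedges have weight >= 6 (over
-- ordered pairs); this is where t >= 2 is needed.  In each remaining (heavy) hyperedge all pairs have codegree >= t
-- and each triple has a pair of codegree >= 2 t, so some pair xy has an apex z such that xy can be replaced by
-- the path x z y with disjoint sets of t hyperedges.  If there are many heavy hyperedges, then either
-- they have a subfamily in which all pairs that occur have huge codegree, where a Berge cycle is found greedily, or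
-- such pairs xy have positive density.  Thinned out to have disjoint sets of t hyperedges, they contain a large
-- complete bipartite graph, hence even cycles; replacing one edge by a path through its apex gives the odd ones.
-- The triangle only occurs for r = 3 and t = 2, where the charging alone suffices.
module Submission where

open import Defs
open import Data.Bool using (Bool; true; false; not; if_then_else_)
open import Data.Bool.Properties using (not-injective)
open import Data.Empty using (⊥; ⊥-elim)
open import Data.Fin using (Fin; zero; suc; toℕ; inject₁; fromℕ; fromℕ<; punchOut; funToFin; finToFun;
  combine; remQuot; splitAt; _↑ˡ_; _↑ʳ_)
open import Data.Fin.Properties using (any?; _≟_; toℕ-injective; toℕ-fromℕ<; toℕ-fromℕ; toℕ-inject₁; toℕ<n; pigeonhole;
  punchIn-punchOut; punchOut-injective; finToFun-funToFin; fromℕ≢inject₁; remQuot-combine; combine-remQuot;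
  combine-injectiveˡ; combine-injectiveʳ; splitAt-↑ˡ; splitAt-↑ʳ; splitAt⁻¹-↑ˡ; splitAt⁻¹-↑ʳ; ↑ˡ-injective; ↑ʳ-injective)
import Data.Fin.Properties as Finₚ
open import Data.Fin.Relation.Unary.Top using (view; ‵fromℕ; ‵inject₁)
open import Data.Fin.Subset using (Subset; _∈_; ∣_∣)
open import Data.Fin.Subset.Properties using (_∈?_; ⊆-antisym)
open import Data.Nat using (ℕ; zero; suc; _+_; _*_; _∸_; _^_; _≤_; _<_; _<?_; _≤?_; z≤n; s≤s; s<s; NonZero; >-nonZero)
open import Data.Nat.Combinatorics using (_C_; nC1≡n; nCk+nC[k+1]≡[n+1]C[k+1])
open import Data.Nat.Properties hiding (_≟_)
open import Data.Nat.Tactic.RingSolver using (solve-∀)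
open import Data.Product using (Σ; _×_; _,_; ∃; ∃-syntax; proj₁; proj₂)
open import Data.Sum using (_⊎_; inj₁; inj₂)
open import Data.Unit using (tt)
open import Data.Vec using ([]; _∷_; tabulate)
open import Data.Vec.Functional using (removeAt)
open import Data.Vec.Properties using (lookup∘tabulate; []=⇒lookup; lookup⇒[]=)
open import Function using (_∘_; id)
open import Function.Definitions using (Injective)
open import Relation.Binary.PropositionalEquality using (_≡_; _≢_; refl; sym; trans; cong; cong₂; subst; subst₂; ≢-sym)
open import Relation.Nullary using (Dec; yes; no; ¬_; ¬?; does; _×-dec_; _⊎-dec_; contradiction)
open import Relation.Nullary.Decidable using (decidable-stable; dec-true; dec-false)
open import Relation.Unary using (Decidable)
import Algebra.Properties.Semiring.Sum +-*-semiring as Sum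

private variable
  m n q c t M : ℕ
  A P Q R : Set

-- Sums and counting

-- The Iverson bracket: counts become sums, and double counting becomes an exchange of summations.
⟦_⟧ : Dec P → ℕ
⟦ d ⟧ = if does d then 1 else 0

⟦⟧-mono : (p? : Dec P) (q? : Dec Q) → (P → Q) → ⟦ p? ⟧ ≤ ⟦ q? ⟧
⟦⟧-mono (no _)  _       _   = z≤n
⟦⟧-mono (yes _) (yes _) _   = ≤-refl
⟦⟧-mono (yes p) (no ¬q) P⇒Q = contradiction (P⇒Q p) ¬q

⟦⟧-true : (p? : Dec P) → P → ⟦ p? ⟧ ≡ 1
⟦⟧-true p? p rewrite dec-true p? p = refl

⟦⟧-false : (p? : Dec P) → ¬ P → ⟦ p? ⟧ ≡ 0
⟦⟧-false p? ¬p rewrite dec-false p? ¬p = refl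

⟦⟧-⊎ : (p? : Dec P) (q? : Dec Q) (r? : Dec R) → (P → Q ⊎ R) → ⟦ p? ⟧ ≤ ⟦ q? ⟧ + ⟦ r? ⟧
⟦⟧-⊎ (no _)  _  _  _ = z≤n
⟦⟧-⊎ (yes p) q? r? f with f p
... | inj₁ q rewrite ⟦⟧-true q? q = s≤s z≤n
... | inj₂ r rewrite ⟦⟧-true r? r = m≤n+m 1 ⟦ q? ⟧

⟦⟧-¬ : (p? : Dec P) → ⟦ p? ⟧ + ⟦ ¬? p? ⟧ ≡ 1
⟦⟧-¬ (no _)  = refl
⟦⟧-¬ (yes _) = refl

-- The pointwise form of averaging arguments: summed over an index, it bounds from below how often P
-- holds, since the indices without P contribute at most `b` each.
⟦⟧-split : (p? : Dec P) → ∀ {a b c} → (P → a ≤ c) → (¬ P → a ≤ b) → a ≤ b + c * ⟦ p? ⟧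
⟦⟧-split (yes p) {a} {b} {c} a≤c _ = ≤-trans (a≤c p) (≤-trans (≤-reflexive (sym (*-identityʳ c))) (m≤n+m (c * 1) b))
⟦⟧-split (no ¬p) {a} {b} {c} _ a≤b = ≤-trans (a≤b ¬p) (m≤m+n b (c * 0))

⟦⟧-scale : (p? : Dec P) → ∀ {a c} → (P → c ≤ a) → c * ⟦ p? ⟧ ≤ a
⟦⟧-scale (yes p) {a} {c} c≤a = ≤-trans (≤-reflexive (*-identityʳ c)) (c≤a p)
⟦⟧-scale (no ¬p) {a} {c} _   = ≤-trans (≤-reflexive (*-zeroʳ c)) z≤n

⟦⟧≤1 : (p? : Dec P) → ⟦ p? ⟧ ≤ 1
⟦⟧≤1 p? = ⟦⟧-mono p? (yes tt) (λ _ → tt)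

-- Opaque, so that unification can read off the range and the summand of a sum.
opaque
  sum : (Fin n → ℕ) → ℕ
  sum = Sum.sum

  sum-zero : (f : Fin 0 → ℕ) → sum f ≡ 0
  sum-zero f = refl

  sum-suc : (f : Fin (suc n) → ℕ) → sum f ≡ f zero + sum (f ∘ suc)
  sum-suc f = refl

  sum-cong-≗ : {f g : Fin n → ℕ} → (∀ i → f i ≡ g i) → sum f ≡ sum g
  sum-cong-≗ = Sum.sum-cong-≗

  ∑-distrib-+ : (f g : Fin n → ℕ) → sum (λ i → f i + g i) ≡ sum f + sum g
  ∑-distrib-+ = Sum.∑-distrib-+

  ∑-comm : (f : Fin m → Fin n → ℕ) → sum (λ i → sum (f i)) ≡ sum (λ j → sum (λ i → f i j))
  ∑-comm = Sum.∑-comm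

  *-distribˡ-sum : ∀ c (f : Fin n → ℕ) → c * sum f ≡ sum (λ i → c * f i)
  *-distribˡ-sum = Sum.*-distribˡ-sum

  *-distribʳ-sum : ∀ c (f : Fin n → ℕ) → sum f * c ≡ sum (λ i → f i * c)
  *-distribʳ-sum = Sum.*-distribʳ-sum

  sum-mono : {f g : Fin n → ℕ} → (∀ i → f i ≤ g i) → sum f ≤ sum g
  sum-mono {n = zero}  f≤g = z≤n
  sum-mono {n = suc n} f≤g = +-mono-≤ (f≤g zero) (sum-mono (f≤g ∘ suc))

  sum-mono-< : {f g : Fin n → ℕ} → (∀ i → f i ≤ g i) → ∀ j → f j < g j → sum f < sum g
  sum-mono-< {n = suc n} f≤g zero    f<g = +-mono-<-≤ f<g (sum-mono (f≤g ∘ suc))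
  sum-mono-< {n = suc n} f≤g (suc j) f<g = +-mono-≤-< (f≤g zero) (sum-mono-< (f≤g ∘ suc) j f<g)

  sum-const : ∀ n c → sum {n} (λ _ → c) ≡ n * c
  sum-const zero    c = refl
  sum-const (suc n) c = cong (c +_) (sum-const n c)

  -- Induction on the number of terms: the index `φ zero` is removed from the range and the other
  -- indices are renumbered by `punchOut`.
  sum-injective-≤ : (f : Fin n → ℕ) {φ : Fin m → Fin n} → Injective _≡_ _≡_ φ → sum (f ∘ φ) ≤ sum f
  sum-injective-≤ {m = zero}  f inj = z≤n
  sum-injective-≤ {n = zero} {m = suc m} f {φ} inj with () ← φ zero
  sum-injective-≤ {n = suc n} {m = suc m} f {φ} inj = begin
    f (φ zero) + sum (f ∘ φ ∘ suc)                    ≡⟨ cong (f (φ zero) +_) (sum-cong-≗ λ j → cong f (sym (punchIn-punchOut (φ₀≢ j)))) ⟩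
    f (φ zero) + sum (removeAt f (φ zero) ∘ ψ)        ≤⟨ +-monoʳ-≤ (f (φ zero)) (sum-injective-≤ (removeAt f (φ zero)) ψ-inj) ⟩
    f (φ zero) + sum (removeAt f (φ zero))            ≡⟨ Sum.sum-remove f ⟨
    sum f                                             ∎
    where
    open ≤-Reasoning
    φ₀≢ : ∀ j → φ zero ≢ φ (suc j)
    φ₀≢ j eq with () ← inj eq
    ψ : Fin m → Fin n
    ψ j = punchOut (φ₀≢ j)
    ψ-inj : Injective _≡_ _≡_ ψ
    ψ-inj {i} {j} eq = Finₚ.suc-injective (inj (punchOut-injective (φ₀≢ i) (φ₀≢ j) eq))

sum-≤ : {f : Fin n → ℕ} → (∀ i → f i ≤ c) → sum f ≤ n * c
sum-≤ {n = n} {c} f≤c = ≤-trans (sum-mono f≤c) (≤-reflexive (sum-const n c))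

sum-exceeds : (f : Fin n → ℕ) → n * c < sum f → ∃[ i ] c < f i
sum-exceeds {c = c} f big with any? (λ i → c <? f i)
... | yes found = found
... | no none   = contradiction (sum-≤ (λ i → ≮⇒≥ (λ c<f → none (i , c<f)))) (<⇒≱ big)

term≤sum : (f : Fin n → ℕ) → ∀ i → f i ≤ sum f
term≤sum f i = ≤-trans (≤-trans (m≤m+n (f i) 0) (≤-reflexive (sym (sum-const 1 (f i))))) (sum-injective-≤ f {λ (_ : Fin 1) → i} λ { {zero} {zero} _ → refl })

count : {P : Fin n → Set} → Decidable P → ℕ
count P? = sum (λ i → ⟦ P? i ⟧)

count-mono : {P Q : Fin n → Set} (P? : Decidable P) (Q? : Decidable Q) →
             (∀ i → P i → Q i) → count P? ≤ count Q?
count-mono P? Q? P⇒Q = sum-mono (λ i → ⟦⟧-mono (P? i) (Q? i) (P⇒Q i))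

count-cong : {P Q : Fin n → Set} (P? : Decidable P) (Q? : Decidable Q) →
             (∀ i → P i → Q i) → (∀ i → Q i → P i) → count P? ≡ count Q?
count-cong P? Q? P⇒Q Q⇒P = ≤-antisym (count-mono P? Q? P⇒Q) (count-mono Q? P? Q⇒P)

count-⊎ : {P Q R : Fin n → Set} (P? : Decidable P) (Q? : Decidable Q) (R? : Decidable R) →
          (∀ i → P i → Q i ⊎ R i) → count P? ≤ count Q? + count R?
count-⊎ P? Q? R? f = ≤-trans (sum-mono (λ i → ⟦⟧-⊎ (P? i) (Q? i) (R? i) (f i)))
                             (≤-reflexive (∑-distrib-+ (λ i → ⟦ Q? i ⟧) (λ i → ⟦ R? i ⟧)))

count≤ : {P : Fin n → Set} (P? : Decidable P) → count P? ≤ n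
count≤ {n} P? = ≤-trans (sum-≤ {n = n} (⟦⟧≤1 ∘ P?)) (≤-reflexive (*-identityʳ n))

count-¬ : {P : Fin n → Set} (P? : Decidable P) → count P? + count (¬? ∘ P?) ≡ n
count-¬ {n} P? = trans (sym (∑-distrib-+ (λ i → ⟦ P? i ⟧) (λ i → ⟦ ¬? (P? i) ⟧)))
  (trans (sum-cong-≗ (⟦⟧-¬ ∘ P?)) (trans (sum-const n 1) (*-identityʳ n)))

count-none : {P : Fin n → Set} (P? : Decidable P) → (∀ i → ¬ P i) → count P? ≡ 0
count-none {n} P? none = trans (sum-cong-≗ (λ i → ⟦⟧-false (P? i) (none i))) (trans (sum-const n 0) (*-zeroʳ n))

count-≟ : (j : Fin n) → count (λ i → i ≟ j) ≡ 1
count-≟ zero    = trans (sum-suc _) (cong suc (count-none (λ i → suc i ≟ zero) λ i ()))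
count-≟ (suc j) = trans (sum-suc _) (trans (count-cong (λ i → suc i ≟ suc j) (λ i → i ≟ j)
                          (λ i → Finₚ.suc-injective) (λ i → cong suc)) (count-≟ j))

abstract
  count-member : {P : Fin n → Set} (P? : Decidable P) → 0 < count P? → ∃ P
  count-member {n} P? pos with sum-exceeds (λ i → ⟦ P? i ⟧) (subst (_< count P?) (sym (*-zeroʳ n)) pos)
  ... | i , 0<1 with P? i
  ...   | yes p = i , p

-- The union bound, by exchanging the two summations.
count-any : {P : Fin q → Fin n → Set} (P? : ∀ u → Decidable (P u)) →
            count (λ i → any? (λ u → P? u i)) ≤ sum (λ u → count (P? u))
count-any P? = ≤-trans (sum-mono pointwise) (≤-reflexive (∑-comm (λ i u → ⟦ P? u i ⟧)))
  where
  pointwise : ∀ i → ⟦ any? (λ u → P? u i) ⟧ ≤ sum (λ u → ⟦ P? u i ⟧)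
  pointwise i with any? (λ u → P? u i)
  ... | no _        = z≤n
  ... | yes (u , p) = ≤-trans (≤-reflexive (sym (⟦⟧-true (P? u i) p))) (term≤sum (λ u → ⟦ P? u i ⟧) u)

count₂ : {P : Fin m → Fin n → Set} → (∀ x y → Dec (P x y)) → ℕ
count₂ P? = sum (λ x → count (P? x))

count₂-⊎ : {P Q R : Fin m → Fin n → Set} (P? : ∀ x y → Dec (P x y)) (Q? : ∀ x y → Dec (Q x y))
           (R? : ∀ x y → Dec (R x y)) → (∀ x y → P x y → Q x y ⊎ R x y) → count₂ P? ≤ count₂ Q? + count₂ R?
count₂-⊎ P? Q? R? f = ≤-trans (sum-mono (λ x → count-⊎ (P? x) (Q? x) (R? x) (f x)))
                              (≤-reflexive (∑-distrib-+ (λ x → count (Q? x)) (λ x → count (R? x))))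

-- Strictness at a single pair is what lowers the fuel in the greedy procedures below and what pays
-- for one deletion or one choice.
count₂-mono-< : {P Q : Fin m → Fin n → Set} (P? : ∀ x y → Dec (P x y)) (Q? : ∀ x y → Dec (Q x y)) →
                (∀ x y → P x y → Q x y) → ∀ x y → ¬ P x y → Q x y → count₂ P? < count₂ Q?
count₂-mono-< P? Q? P⇒Q x y ¬p q =
  sum-mono-< (λ x → count-mono (P? x) (Q? x) (P⇒Q x)) x
    (sum-mono-< (λ y → ⟦⟧-mono (P? x y) (Q? x y) (P⇒Q x y)) y
      (subst (_< ⟦ Q? x y ⟧) (sym (⟦⟧-false (P? x y) ¬p)) (≤-reflexive (sym (⟦⟧-true (Q? x y) q)))))

count₂-none : {P : Fin m → Fin n → Set} (P? : ∀ x y → Dec (P x y)) → (∀ x y → ¬ P x y) → count₂ P? ≡ 0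
count₂-none {m} P? none = trans (sum-cong-≗ (λ x → count-none (P? x) (none x))) (trans (sum-const m 0) (*-zeroʳ m))

-- Greedy selection

abstract
  -- Greedy choice: when representative i is picked, at most i elements of D i are already taken.
  distinct-representatives : {D : Fin q → Fin m → Set} (D? : ∀ i → Decidable (D i)) →
    (∀ i → toℕ i < count (D? i)) → Σ (Fin q → Fin m) λ f → Injective _≡_ _≡_ f × (∀ i → D i (f i))
  distinct-representatives {q = zero} D? big = (λ ()) , (λ { {()} }) , λ ()
  distinct-representatives {q = suc q} {m} {D} D? big = f , f-inj , f∈D
    where
    first : ∃ (D zero)
    first = count-member (D? zero) (big zero)
    x : Fin m
    x = proj₁ first
    D′? : ∀ i → Decidable (λ y → D (suc i) y × y ≢ x)
    D′? i y = D? (suc i) y ×-dec ¬? (y ≟ x)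
    step : ∀ i → count (D? (suc i)) ≤ 1 + count (D′? i)
    step i = ≤-trans (count-⊎ (D? (suc i)) (_≟ x) (D′? i) split)
                     (+-monoˡ-≤ _ (≤-reflexive (count-≟ x)))
      where
      split : ∀ y → D (suc i) y → y ≡ x ⊎ D (suc i) y × y ≢ x
      split y d with y ≟ x
      ... | yes y≡x = inj₁ y≡x
      ... | no y≢x  = inj₂ (d , y≢x)
    rest : Σ (Fin q → Fin m) λ g → Injective _≡_ _≡_ g × (∀ i → D (suc i) (g i) × g i ≢ x)
    rest = distinct-representatives D′? (λ i → ≤-pred (≤-trans (big (suc i)) (step i)))
    f : Fin (suc q) → Fin m
    f zero    = x
    f (suc i) = proj₁ rest i
    f-inj : Injective _≡_ _≡_ f
    f-inj {zero}  {zero}  _  = refl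
    f-inj {zero}  {suc j} eq = contradiction (sym eq) (proj₂ (proj₂ (proj₂ rest) j))
    f-inj {suc i} {zero}  eq = contradiction eq (proj₂ (proj₂ (proj₂ rest) i))
    f-inj {suc i} {suc j} eq = cong suc (proj₁ (proj₂ rest) eq)
    f∈D : ∀ i → D i (f i)
    f∈D zero    = proj₂ first
    f∈D (suc i) = proj₁ (proj₂ (proj₂ rest) i)

  distinct-members : {D : Fin m → Set} (D? : Decidable D) → q ≤ count D? →
                     Σ (Fin q → Fin m) λ f → Injective _≡_ _≡_ f × (∀ i → D (f i))
  distinct-members {q = q} D? q≤ = distinct-representatives (λ _ → D?) (λ i → ≤-trans (Finₚ.toℕ<n i) q≤)

abstract
  -- A pattern on `Fin m` becomes one of `2 ^ m` numbers, so that `pigeonhole` and sums over `Fin`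
  -- can range over patterns.
  pattern-code : {P : Fin m → Set} → Decidable P → Fin (2 ^ m)
  pattern-code P? = funToFin (λ i → if does (P? i) then suc zero else (zero {1}))

  pattern-code-≡ : {P Q : Fin m → Set} (P? : Decidable P) (Q? : Decidable Q) →
                   pattern-code P? ≡ pattern-code Q? → ∀ i → P i → Q i
  pattern-code-≡ {m} P? Q? eq i p with P? i | Q? i | same-bit
    where
    bit : ∀ {R : Set} → Dec R → Fin 2
    bit R? = if does R? then suc zero else zero
    same-bit : bit (P? i) ≡ bit (Q? i)
    same-bit = trans (sym (finToFun-funToFin (bit ∘ P?) i))
                     (trans (cong (λ k → finToFun k i) eq) (finToFun-funToFin (bit ∘ Q?) i))
  ... | no ¬p | _     | _ = contradiction p ¬p
  ... | yes _ | yes q | _ = q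

-- Deleting a pair of E that lies in fewer than T surviving members of S, together with
-- these members, costs at most T members per pair, so a large S cannot be exhausted.
module _ {n M : ℕ} {I : Fin n → Fin n → Fin M → Set} (I? : ∀ x y → Decidable (I x y)) (T : ℕ) where

  record Core (S : Fin M → Set) (E : Fin n → Fin n → Set) : Set₁ where
    field
      {Member} : Fin M → Set
      member?  : Decidable Member
      nonempty : ∃ Member
      member⊆  : ∀ {a} → Member a → S a
      popular  : ∀ {a x y} → Member a → E x y → I x y a → T ≤ count (λ b → member? b ×-dec I? x y b)

  -- `fuel` bounds the number of pairs left and makes the recursion structural.
  core-or-few : ∀ fuel {S : Fin M → Set} (S? : Decidable S)
                {E : Fin n → Fin n → Set} (E? : ∀ x y → Dec (E x y)) → count₂ E? ≤ fuel →
                (∀ a → S a → ∃[ x ] ∃[ y ] E x y × I x y a) → Core S E ⊎ count S? ≤ T * count₂ E?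
  core-or-few fuel {S} S? {E} E? bound covered
    with any? (λ x → any? (λ y → E? x y ×-dec (count (λ b → S? b ×-dec I? x y b) <? T)))
  ... | no allPopular with any? S?
  ...   | yes (a , s) = inj₁ record
            { member? = S? ; nonempty = a , s ; member⊆ = id
            ; popular = λ {_} {x} {y} _ e _ → ≮⇒≥ (λ few → allPopular (x , y , e , few)) }
  ...   | no empty = inj₂ (subst (_≤ T * count₂ E?) (sym (count-none S? (λ a s → empty (a , s)))) z≤n)
  core-or-few zero S? E? bound covered
      | yes (x , y , e , few) =
        contradiction (≤-trans (count₂-mono-< (λ _ _ → no id) E? (λ _ _ ()) x y id e) bound) λ ()
  core-or-few (suc fuel) {S} S? {E} E? bound covered
      | yes (x , y , e , few) with core-or-few fuel S′? E′? (≤-pred (≤-trans E′<E bound)) covered′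
    where
    S′ : Fin M → Set
    S′ a = S a × ¬ I x y a
    S′? : Decidable S′
    S′? a = S? a ×-dec ¬? (I? x y a)
    E′ : Fin n → Fin n → Set
    E′ u v = E u v × ¬ (u ≡ x × v ≡ y)
    E′? : ∀ u v → Dec (E′ u v)
    E′? u v = E? u v ×-dec ¬? ((u ≟ x) ×-dec (v ≟ y))
    E′<E : count₂ E′? < count₂ E?
    E′<E = count₂-mono-< E′? E? (λ _ _ → proj₁) x y (λ e′ → proj₂ e′ (refl , refl)) e
    covered′ : ∀ a → S′ a → ∃[ u ] ∃[ v ] E′ u v × I u v a
    covered′ a (s , ¬i) with covered a s
    ... | u , v , e′ , i = u , v , (e′ , λ { (refl , refl) → ¬i i }) , i
  ...   | inj₁ core = inj₁ record
            { member? = Core.member? core ; nonempty = Core.nonempty core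
            ; member⊆ = proj₁ ∘ Core.member⊆ core
            -- No surviving member is incident with the deleted pair, so the smaller core is also
            -- one for the original E.
            ; popular = λ m e′ i → Core.popular core m
                (e′ , λ { (refl , refl) → proj₂ (Core.member⊆ core m) i }) i }
  ...   | inj₂ le = inj₂ (begin
            count S?                                       ≤⟨ count-⊎ S? (λ b → S? b ×-dec I? x y b) S′? split ⟩
            count (λ b → S? b ×-dec I? x y b) + count S′?  ≤⟨ +-mono-≤ (<⇒≤ few) le ⟩
            T + T * count₂ E′?                             ≡⟨ *-suc T (count₂ E′?) ⟨
            T * suc (count₂ E′?)                           ≤⟨ *-monoʳ-≤ T E′<E ⟩
            T * count₂ E?                                  ∎)
    where
    open ≤-Reasoning
    S′? : Decidable (λ a → S a × ¬ I x y a)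
    S′? a = S? a ×-dec ¬? (I? x y a)
    E′? : ∀ u v → Dec (E u v × ¬ (u ≡ x × v ≡ y))
    E′? u v = E? u v ×-dec ¬? ((u ≟ x) ×-dec (v ≟ y))
    E′<E : count₂ E′? < count₂ E?
    E′<E = count₂-mono-< E′? E? (λ _ _ → proj₁) x y (λ e′ → proj₂ e′ (refl , refl)) e
    split : ∀ b → S b → (S b × I x y b) ⊎ (S b × ¬ I x y b)
    split b s with I? x y b
    ... | yes i = inj₁ (s , i)
    ... | no ¬i = inj₂ (s , ¬i)

module _ {n : ℕ} {Hit : (x y x′ y′ : Fin n) → Set} (Hit? : ∀ x y x′ y′ → Dec (Hit x y x′ y′)) (c : ℕ) where

  -- `Hit` need not be symmetric, and a greedy choice only discards the pairs hit by earlier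
  -- choices; hence `separate` excludes a hit in one direction only.
  record Independent (E : Fin n → Fin n → Set) (size : ℕ) : Set₁ where
    field
      {Chosen} : Fin n → Fin n → Set
      chosen?  : ∀ x y → Dec (Chosen x y)
      chosen⊆  : ∀ {x y} → Chosen x y → E x y
      separate : ∀ {x y x′ y′} → Chosen x y → Chosen x′ y′ →
                 (x ≡ x′ × y ≡ y′) ⊎ (¬ Hit x y x′ y′) ⊎ (¬ Hit x′ y′ x y)
      large    : size ≤ c * count₂ chosen?

  -- A pair is chosen and the pairs that it hits, at most `c`, are discarded. By `self` the chosen
  -- pair is among them, so the recursion decreases and no pair is counted twice in `large`.
  independent-subset : ∀ fuel {E : Fin n → Fin n → Set} (E? : ∀ x y → Dec (E x y)) → count₂ E? ≤ fuel →
    (∀ {x y} → E x y → Hit x y x y) → (∀ {x y} → E x y → count₂ (Hit? x y) ≤ c) → Independent E (count₂ E?)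
  independent-subset fuel E? bound self few with any? (λ x → any? (E? x))
  ... | no empty = record
    { chosen? = E? ; chosen⊆ = id ; separate = λ e → contradiction (_ , _ , e) empty
    ; large = subst (_≤ c * count₂ E?) (sym (count₂-none E? (λ x y e → empty (x , y , e)))) z≤n }
  independent-subset zero E? bound self few | yes (x , y , e) =
    contradiction (≤-trans (count₂-mono-< (λ _ _ → no id) E? (λ _ _ ()) x y id e) bound) λ ()
  independent-subset (suc fuel) {E} E? bound self few | yes (x , y , e) = record
    { chosen?  = λ u v → chosen⁺? u v
    ; chosen⊆  = λ { (inj₁ (refl , refl)) → e ; (inj₂ ch) → proj₁ (Ind.chosen⊆ ch) }
    ; separate = separate⁺
    ; large    = begin
        count₂ E?                          ≤⟨ count₂-⊎ E? (Hit? x y) E′? split ⟩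
        count₂ (Hit? x y) + count₂ E′?     ≤⟨ +-mono-≤ (few e) Ind.large ⟩
        c + c * count₂ Ind.chosen?         ≡⟨ *-suc c _ ⟨
        c * suc (count₂ Ind.chosen?)       ≤⟨ *-monoʳ-≤ c (count₂-mono-< Ind.chosen? chosen⁺? (λ _ _ → inj₂) x y
                                                (λ ch → proj₂ (Ind.chosen⊆ ch) (self e)) (inj₁ (refl , refl))) ⟩
        c * count₂ chosen⁺?                ∎ }
    where
    open ≤-Reasoning
    E′ : Fin n → Fin n → Set
    E′ u v = E u v × ¬ Hit x y u v
    E′? : ∀ u v → Dec (E′ u v)
    E′? u v = E? u v ×-dec ¬? (Hit? x y u v)
    split : ∀ u v → E u v → Hit x y u v ⊎ E′ u v
    split u v e′ with Hit? x y u v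
    ... | yes hit = inj₁ hit
    ... | no ¬hit = inj₂ (e′ , ¬hit)
    ind : Independent E′ (count₂ E′?)
    ind = independent-subset fuel E′?
      (≤-pred (≤-trans (count₂-mono-< E′? E? (λ _ _ → proj₁) x y (λ e′ → proj₂ e′ (self e)) e) bound))
      (self ∘ proj₁) (few ∘ proj₁)
    module Ind = Independent ind
    Chosen⁺ : Fin n → Fin n → Set
    Chosen⁺ u v = (u ≡ x × v ≡ y) ⊎ Ind.Chosen u v
    chosen⁺? : ∀ u v → Dec (Chosen⁺ u v)
    chosen⁺? u v = ((u ≟ x) ×-dec (v ≟ y)) ⊎-dec Ind.chosen? u v
    separate⁺ : ∀ {u v u′ v′} → Chosen⁺ u v → Chosen⁺ u′ v′ →
                (u ≡ u′ × v ≡ v′) ⊎ (¬ Hit u v u′ v′) ⊎ (¬ Hit u′ v′ u v)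
    separate⁺ (inj₁ (refl , refl)) (inj₁ (refl , refl)) = inj₁ (refl , refl)
    separate⁺ (inj₁ (refl , refl)) (inj₂ ch)            = inj₂ (inj₁ (proj₂ (Ind.chosen⊆ ch)))
    separate⁺ (inj₂ ch)            (inj₁ (refl , refl)) = inj₂ (inj₂ (proj₂ (Ind.chosen⊆ ch)))
    separate⁺ (inj₂ ch)            (inj₂ ch′)           = Ind.separate ch ch′

-- Complete bipartite subgraphs of dense graphs

record CompleteBipartite (s : ℕ) {n : ℕ} (G : Fin n → Fin n → Set) : Set where
  field
    left            : Fin s → Fin n
    right           : Fin s → Fin n
    left-injective  : Injective _≡_ _≡_ left
    right-injective : Injective _≡_ _≡_ right
    -- For an irreflexive `G` this makes the two sides disjoint.
    complete        : ∀ i j → G (left i) (right j)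

-- At least n / 4D columns meet s or more of the given rows, which have degree at least n / 2D each;
-- among 2 ^ rows * s + 1 such columns more than s have the same pattern on the rows.
module _ (D s : ℕ) .{{_ : NonZero D}} .{{_ : NonZero s}} where
  rows : ℕ
  rows = 4 * D * s

  columns : ℕ
  columns = suc (2 ^ rows * s)

  kővári-sós-turán-threshold : ℕ
  kővári-sós-turán-threshold = suc (2 * D * rows + 4 * D * columns)

  complete-bipartite : ∀ {n} {G : Fin n → Fin n → Set} (G? : ∀ x y → Dec (G x y)) →
    kővári-sós-turán-threshold ≤ n → n * n ≤ D * count₂ G? → CompleteBipartite s G
  complete-bipartite {n} {G} G? n-large dense = record
    { left            = w ∘ proj₁ chosenRows
    ; right           = u ∘ proj₁ chosenColumns
    ; left-injective  = λ {i} {j} eq → proj₁ (proj₂ chosenRows) (proj₁ (proj₂ highRows) {proj₁ chosenRows i} {proj₁ chosenRows j} eq)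
    ; right-injective = λ {i} {j} eq → proj₁ (proj₂ chosenColumns) (proj₁ (proj₂ richColumns) {proj₁ chosenColumns i} {proj₁ chosenColumns j} eq)
    -- All chosen columns share the pattern of the reference column `j₀`, and the chosen rows are
    -- rows that meet `j₀`.
    ; complete        = λ i j → pattern-code-≡ (λ k → G? (w k) (u j₀)) (λ k → G? (w k) (u (proj₁ chosenColumns j)))
        (trans φj₀ (sym (proj₂ (proj₂ chosenColumns) j))) _ (proj₂ (proj₂ chosenRows) i)
    }
    where
    open ≤-Reasoning
    instance
      n≢0 : NonZero n
      n≢0 = >-nonZero (≤-trans (s≤s z≤n) n-large)
      2Ds≢0 : NonZero (2 * D * s)
      2Ds≢0 = m*n≢0 (2 * D) s {{m*n≢0 2 D}}
    deg : Fin n → ℕ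
    deg x = count (G? x)
    High : Fin n → Set
    High x = n ≤ 2 * D * deg x
    high? : Decidable High
    high? x = n ≤? 2 * D * deg x
    deg-split : ∀ x → 2 * D * deg x ≤ n + 2 * D * n * ⟦ high? x ⟧
    deg-split x = ⟦⟧-split (high? x) (λ _ → *-monoʳ-≤ (2 * D) (count≤ (G? x))) (<⇒≤ ∘ ≰⇒>)
    -- After multiplication by `2 * D` the degrees sum to at least `2 * n * n`, of which the rows of
    -- low degree give at most `n * n`.
    many-high : n ≤ 2 * D * count high?
    many-high = *-cancelˡ-≤ n (+-cancelˡ-≤ (n * n) _ _ (begin
      n * n + n * n                                    ≤⟨ +-mono-≤ dense dense ⟩
      D * sum deg + D * sum deg                        ≡⟨ lemma₁ D (sum deg) ⟩
      2 * D * sum deg                                  ≡⟨ *-distribˡ-sum (2 * D) deg ⟩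
      sum (λ x → 2 * D * deg x)                        ≤⟨ sum-mono deg-split ⟩
      sum (λ x → n + 2 * D * n * ⟦ high? x ⟧)          ≡⟨ ∑-distrib-+ (λ _ → n) (λ x → 2 * D * n * ⟦ high? x ⟧) ⟩
      sum {n} (λ _ → n) + sum (λ x → 2 * D * n * ⟦ high? x ⟧)  ≡⟨ cong₂ _+_ (sum-const n n) (sym (*-distribˡ-sum (2 * D * n) (λ x → ⟦ high? x ⟧))) ⟩
      n * n + 2 * D * n * count high?                  ≡⟨ cong (n * n +_) (lemma₂ D n (count high?)) ⟩
      n * n + n * (2 * D * count high?)                ∎))
      where
      lemma₁ : ∀ D x → D * x + D * x ≡ 2 * D * x
      lemma₁ = solve-∀
      lemma₂ : ∀ D n x → 2 * D * n * x ≡ n * (2 * D * x)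
      lemma₂ = solve-∀
    highRows : Σ (Fin rows → Fin n) λ w → Injective _≡_ _≡_ w × (∀ i → High (w i))
    highRows = distinct-members high? (≮⇒≥ λ few → <⇒≱ n-large (begin
      n                                        ≤⟨ many-high ⟩
      2 * D * count high?                      ≤⟨ *-monoʳ-≤ (2 * D) (<⇒≤ few) ⟩
      2 * D * rows                             ≤⟨ m≤m+n _ _ ⟩
      2 * D * rows + 4 * D * columns           ∎))
    w : Fin rows → Fin n
    w = proj₁ highRows
    met : Fin n → ℕ
    met v = count (λ i → G? (w i) v)
    Rich : Fin n → Set
    Rich v = s ≤ met v
    rich? : Decidable Rich
    rich? v = s ≤? met v
    met-split : ∀ v → met v ≤ s + rows * ⟦ rich? v ⟧
    met-split v = ⟦⟧-split (rich? v) (λ _ → count≤ (λ i → G? (w i) v)) (<⇒≤ ∘ ≰⇒>)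
    rows-met : rows * n ≤ 2 * D * (n * s + rows * count rich?)
    rows-met = begin
      rows * n                                  ≡⟨ sum-const rows n ⟨
      sum {rows} (λ _ → n)                      ≤⟨ sum-mono (proj₂ (proj₂ highRows)) ⟩
      sum (λ i → 2 * D * deg (w i))             ≡⟨ *-distribˡ-sum (2 * D) (deg ∘ w) ⟨
      2 * D * sum (deg ∘ w)                     ≡⟨ cong (2 * D *_) (∑-comm (λ i v → ⟦ G? (w i) v ⟧)) ⟩
      2 * D * sum met                           ≤⟨ *-monoʳ-≤ (2 * D) (sum-mono met-split) ⟩
      2 * D * sum (λ v → s + rows * ⟦ rich? v ⟧)  ≡⟨ cong (2 * D *_) (∑-distrib-+ (λ _ → s) (λ v → rows * ⟦ rich? v ⟧)) ⟩
      2 * D * (sum {n} (λ _ → s) + sum (λ v → rows * ⟦ rich? v ⟧))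
        ≡⟨ cong (2 * D *_) (cong₂ _+_ (sum-const n s) (sym (*-distribˡ-sum rows (λ v → ⟦ rich? v ⟧)))) ⟩
      2 * D * (n * s + rows * count rich?)      ∎
    -- As `rows` is `4 * D * s`, the columns met fewer than `s` times account for at most half of
    -- `rows * n`.
    many-rich : 2 * D * s * n ≤ 2 * D * s * (4 * D * count rich?)
    many-rich = +-cancelˡ-≤ (2 * D * (n * s)) _ _ (begin
      2 * D * (n * s) + 2 * D * s * n                 ≡⟨ lemma₁ D s n ⟩
      rows * n                                        ≤⟨ rows-met ⟩
      2 * D * (n * s + rows * count rich?)            ≡⟨ lemma₂ D s n (count rich?) ⟩
      2 * D * (n * s) + 2 * D * s * (4 * D * count rich?)  ∎)
      where
      lemma₁ : ∀ D s n → 2 * D * (n * s) + 2 * D * s * n ≡ 4 * D * s * n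
      lemma₁ = solve-∀
      lemma₂ : ∀ D s n x → 2 * D * (n * s + 4 * D * s * x) ≡ 2 * D * (n * s) + 2 * D * s * (4 * D * x)
      lemma₂ = solve-∀
    richColumns : Σ (Fin columns → Fin n) λ u → Injective _≡_ _≡_ u × (∀ j → Rich (u j))
    richColumns = distinct-members rich? (≮⇒≥ λ few → <⇒≱ n-large (begin
      n                                        ≤⟨ *-cancelˡ-≤ (2 * D * s) many-rich ⟩
      4 * D * count rich?                      ≤⟨ *-monoʳ-≤ (4 * D) (<⇒≤ few) ⟩
      4 * D * columns                          ≤⟨ m≤n+m _ _ ⟩
      2 * D * rows + 4 * D * columns           ∎))
    u : Fin columns → Fin n
    u = proj₁ richColumns
    φ : Fin columns → Fin (2 ^ rows)
    φ j = pattern-code (λ i → G? (w i) (u j))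
    popularPattern : ∃[ π ] s < count (λ j → φ j ≟ π)
    popularPattern = sum-exceeds (λ π → count (λ j → φ j ≟ π)) (begin
      columns                                                ≡⟨ *-identityʳ columns ⟨
      columns * 1                                            ≡⟨ sum-const columns 1 ⟨
      sum {columns} (λ _ → 1)                                ≡⟨ sum-cong-≗ (λ j → trans (sym (count-≟ (φ j))) (count-cong (_≟ φ j) (φ j ≟_) (λ _ → sym) (λ _ → sym))) ⟩
      sum {columns} (λ j → count (λ π → φ j ≟ π))            ≡⟨ ∑-comm (λ j π → ⟦ φ j ≟ π ⟧) ⟩
      sum (λ π → count (λ j → φ j ≟ π))                      ∎)
    π : Fin (2 ^ rows)
    π = proj₁ popularPattern
    j₀∈ : ∃[ j ] φ j ≡ π
    j₀∈ = count-member (λ j → φ j ≟ π) (≤-trans (s≤s z≤n) (proj₂ popularPattern))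
    j₀ : Fin columns
    j₀ = proj₁ j₀∈
    φj₀ : φ j₀ ≡ π
    φj₀ = proj₂ j₀∈
    chosenColumns : Σ (Fin s → Fin columns) λ f → Injective _≡_ _≡_ f × (∀ j → φ (f j) ≡ π)
    chosenColumns = distinct-members (λ j → φ j ≟ π) (<⇒≤ (proj₂ popularPattern))
    chosenRows : Σ (Fin s → Fin rows) λ f → Injective _≡_ _≡_ f × (∀ i → G (w (f i)) (u j₀))
    chosenRows = distinct-members (λ i → G? (w i) (u j₀)) (proj₂ (proj₂ richColumns) j₀)

-- Codegrees and Berge cycles

count-∈ : (p : Subset n) → count (_∈? p) ≡ ∣ p ∣
count-∈ []          = sum-zero _
count-∈ (true  ∷ p) = trans (sum-suc _) (cong suc (count-∈ p))
count-∈ (false ∷ p) = trans (sum-suc _) (count-∈ p)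

nextF-inject₁ : (j : Fin m) → nextF (inject₁ j) ≡ suc j
nextF-inject₁ {m} j with suc (toℕ (inject₁ j)) <? suc m
... | yes p = toℕ-injective (trans (toℕ-fromℕ< p) (cong suc (toℕ-inject₁ j)))
... | no ¬p = contradiction (s<s (subst (_< m) (sym (toℕ-inject₁ j)) (toℕ<n j))) ¬p

nextF-fromℕ : ∀ m → nextF (fromℕ m) ≡ zero
nextF-fromℕ m with suc (toℕ (fromℕ m)) <? suc m
... | yes p = contradiction (subst (λ k → suc k < suc m) (toℕ-fromℕ m) p) (<-irrefl refl)
... | no _  = refl

nextF-injective : Injective _≡_ _≡_ (nextF {m})
nextF-injective {m} {i} {j} eq with view i | view j
... | ‵fromℕ     | ‵fromℕ     = refl
... | ‵fromℕ     | ‵inject₁ j′ with () ← trans (sym (nextF-fromℕ m)) (trans eq (nextF-inject₁ j′))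
... | ‵inject₁ i′ | ‵fromℕ     with () ← trans (sym (nextF-fromℕ m)) (trans (sym eq) (nextF-inject₁ i′))
... | ‵inject₁ i′ | ‵inject₁ j′ =
  cong inject₁ (Finₚ.suc-injective (trans (sym (nextF-inject₁ i′)) (trans eq (nextF-inject₁ j′))))

nextF-cases : (j : Fin (suc m)) → toℕ (nextF j) ≡ suc (toℕ j) ⊎ (toℕ j ≡ m × nextF j ≡ zero)
nextF-cases {m} j with view j
... | ‵fromℕ     = inj₂ (toℕ-fromℕ m , nextF-fromℕ m)
... | ‵inject₁ i = inj₁ (trans (cong toℕ (nextF-inject₁ i)) (cong suc (sym (toℕ-inject₁ i))))

nextF≢id : 1 ≤ m → (j : Fin (suc m)) → nextF j ≢ j
nextF≢id 1≤m j eq with nextF-cases j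
... | inj₁ next        = 1+n≢n (trans (sym next) (cong toℕ eq))
... | inj₂ (top , eq₀) = contradiction (subst (1 ≤_) (trans (sym top) (cong toℕ (trans (sym eq) eq₀))) 1≤m) λ ()

-- This keeps consecutive edges of a cycle distinct as unordered pairs, which fails for two
-- vertices.
nextF²≢id : 2 ≤ m → (j : Fin (suc m)) → nextF (nextF j) ≢ j
nextF²≢id {m} 2≤m j eq with nextF-cases j | nextF-cases (nextF j)
... | inj₁ next         | inj₁ next′ =
  m≢1+n+m (toℕ j) {1} (trans (sym (cong toℕ eq)) (trans next′ (cong suc next)))
... | inj₁ next         | inj₂ (top , eq₀) =
  <-irrefl (trans (cong suc (cong toℕ (trans (sym eq₀) eq))) (trans (sym next) top)) 2≤m
... | inj₂ (top , eq₀)  | inj₁ next =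
  <-irrefl (trans (cong suc (sym (cong toℕ eq₀))) (trans (sym next) (trans (cong toℕ eq) top))) 2≤m
... | inj₂ (top , eq₀)  | inj₂ (top′ , _) =
  contradiction (subst (2 ≤_) (trans (sym top′) (cong toℕ eq₀)) 2≤m) λ ()

isEven : ℕ → Bool
isEven zero    = true
isEven (suc n) = not (isEven n)

-- Parity also alternates at the wrap-around: the length is even, so the last position is odd.
isEven-nextF : isEven (suc m) ≡ true → (j : Fin (suc m)) → isEven (toℕ (nextF j)) ≡ not (isEven (toℕ j))
isEven-nextF even j with nextF-cases j
... | inj₁ next        = cong isEven next
... | inj₂ (top , eq₀) = trans (cong (isEven ∘ toℕ) eq₀) (trans (sym even) (cong (not ∘ isEven) (sym top)))

infixl 5 _∷ʳ_
_∷ʳ_ : (Fin m → A) → A → Fin (suc m) → A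
(f ∷ʳ x) i with view i
... | ‵fromℕ     = x
... | ‵inject₁ j = f j

∷ʳ-last : (f : Fin m → A) (x : A) → (f ∷ʳ x) (fromℕ m) ≡ x
-- `view (fromℕ m)` is stuck for a variable `m`; the wrong case is refuted by `fromℕ≢inject₁`.
∷ʳ-last {m} f x with fromℕ m | view (fromℕ m) | Finₚ.fromℕ≢inject₁ {m}
... | _ | ‵fromℕ     | _  = refl
... | _ | ‵inject₁ j | ne = contradiction refl ne

module _ {n M : ℕ} (H : Fin M → Subset n) where

  Joins : Fin n → Fin n → Fin M → Set
  Joins x y a = x ∈ H a × y ∈ H a

  joins? : ∀ x y → Decidable (Joins x y)
  joins? x y a = (x ∈? H a) ×-dec (y ∈? H a)

  Joins-sym : ∀ {x y a} → Joins x y a → Joins y x a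
  Joins-sym (p , q) = q , p

  codegree : Fin n → Fin n → ℕ
  codegree x y = count (joins? x y)

  codegree-sym : ∀ x y → codegree x y ≡ codegree y x
  codegree-sym x y = count-cong (joins? x y) (joins? y x) (λ _ → Joins-sym) (λ _ → Joins-sym)

  -- The path links `h` and the closing bundle `c` are separate arguments because the odd cycle and
  -- the triangle build the closing edge differently from the others.
  berge-cycle : (w : Fin (suc m) → Fin n) → Injective _≡_ _≡_ w →
    (h : Fin m → Fin t → Fin M) (c : Fin t → Fin M) →
    (∀ j s → Joins (w (inject₁ j)) (w (suc j)) (h j s)) →
    (∀ s → Joins (w (fromℕ m)) (w zero) (c s)) →
    (∀ j → Injective _≡_ _≡_ (h j)) → Injective _≡_ _≡_ c →
    (∀ i j s s′ → h i s ≡ h j s′ → i ≡ j) → (∀ j s s′ → h j s ≢ c s′) →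
    BergeIn t (Cycle (suc m)) n M H
  berge-cycle {m} w w-inj h c h-joins c-joins h-inj c-inj h-disj hc-disj =
    w , w-inj , (h ∷ʳ c) , inj , disj , joins
    where
    inj : ∀ f → Injective _≡_ _≡_ ((h ∷ʳ c) f)
    inj f with view f
    ... | ‵fromℕ     = c-inj
    ... | ‵inject₁ j = h-inj j
    disj : ∀ f f′ s s′ → (h ∷ʳ c) f s ≡ (h ∷ʳ c) f′ s′ → f ≡ f′
    disj f f′ s s′ eq with view f | view f′
    ... | ‵fromℕ     | ‵fromℕ     = refl
    ... | ‵fromℕ     | ‵inject₁ j = contradiction (sym eq) (hc-disj j s′ s)
    ... | ‵inject₁ i | ‵fromℕ     = contradiction eq (hc-disj i s s′)
    ... | ‵inject₁ i | ‵inject₁ j = cong inject₁ (h-disj i j s s′ eq)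
    joins : ∀ f s → Joins (w f) (w (nextF f)) ((h ∷ʳ c) f s)
    joins f s with view f
    ... | ‵fromℕ     rewrite nextF-fromℕ m   = c-joins s
    ... | ‵inject₁ j rewrite nextF-inject₁ j = h-joins j s

  -- The closing edge is dropped. In this way upper bounds for cycles become upper bounds for paths.
  berge-path : BergeIn t (Cycle (suc m)) n M H → BergeIn t (Path (suc m)) n M H
  berge-path (w , w-inj , h , h-inj , h-disj , joins) =
    w , w-inj , h ∘ inject₁ , h-inj ∘ inject₁ ,
    (λ i j s s′ eq → Finₚ.inject₁-injective (h-disj _ _ s s′ eq)) ,
    λ j s → proj₁ (joins (inject₁ j) s) , subst (λ v → w v ∈ H (h (inject₁ j) s)) (nextF-inject₁ j) (proj₂ (joins (inject₁ j) s))

berge⇒heavy : ∀ {G} {H : Fin M → Subset n} → BergeIn t G n M H → HeavyIn t G n M H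
berge⇒heavy (w , w-inj , h , h-inj , _ , joins) = w , w-inj , h , h-inj , joins

-- Even cycles alternating between two sides

module Alternating {m n : ℕ} (2≤m : 2 ≤ m) (even : isEven (suc m) ≡ true) (a b : Fin (suc m) → Fin n) where

  vertex : Fin (suc m) → Fin n
  vertex j = if isEven (toℕ j) then a j else b j

  -- Edge j has the ends j and `nextF j`, of different parity; the even one lies in A and the odd
  -- one in B.
  inA inB : Fin (suc m) → Fin (suc m)
  inA j = if isEven (toℕ j) then j else nextF j
  inB j = if isEven (toℕ j) then nextF j else j

  vertex-injective : Injective _≡_ _≡_ a → Injective _≡_ _≡_ b → (∀ i j → a i ≢ b j) → Injective _≡_ _≡_ vertex
  vertex-injective a-inj b-inj a≢b {i} {j} eq with isEven (toℕ i) | isEven (toℕ j)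
  ... | true  | true  = a-inj eq
  ... | false | false = b-inj eq
  ... | true  | false = contradiction eq (a≢b i j)
  ... | false | true  = contradiction (sym eq) (a≢b j i)

  edge-injective : ∀ i j → inA i ≡ inA j → inB i ≡ inB j → i ≡ j
  edge-injective i j eqA eqB with isEven (toℕ i) | isEven (toℕ j)
  ... | true  | true  = eqA
  ... | false | false = eqB
  ... | true  | false = contradiction (trans (cong nextF (sym eqA)) eqB) (nextF²≢id 2≤m j)
  ... | false | true  = contradiction (trans (cong nextF eqA) (sym eqB)) (nextF²≢id 2≤m i)

  edge-ends : (P : Fin n → Set) → ∀ j → P (a (inA j)) → P (b (inB j)) → P (vertex j) × P (vertex (nextF j))
  edge-ends P j pa pb with isEven (toℕ j) | isEven-nextF even j
  ... | true  | next rewrite next = pa , pb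
  ... | false | next rewrite next = pb , pa

  odd-last : isEven (toℕ (fromℕ m)) ≡ false
  odd-last = trans (cong isEven (toℕ-fromℕ m)) (not-injective {isEven m} {false} even)

  -- Hence the last edge joins `a zero` and `b (fromℕ m)`; it is the edge that gives way to a detour
  -- in the odd cycle.
  last-edge : inA (fromℕ m) ≡ zero × inB (fromℕ m) ≡ fromℕ m
  last-edge = trans (cong (if_then fromℕ m else nextF (fromℕ m)) odd-last) (nextF-fromℕ m) ,
              cong (if_then nextF (fromℕ m) else fromℕ m) odd-last

-- Weights of hyperedges

triple : A → A → A → Fin 3 → A
triple x y z zero             = x
triple x y z (suc zero)       = y
triple x y z (suc (suc zero)) = z

triple-injective : {x y z : A} → x ≢ y → y ≢ z → x ≢ z → Injective _≡_ _≡_ (triple x y z)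
triple-injective x≢y y≢z x≢z {zero}           {zero}           _  = refl
triple-injective x≢y y≢z x≢z {zero}           {suc zero}       eq = contradiction eq x≢y
triple-injective x≢y y≢z x≢z {zero}           {suc (suc zero)} eq = contradiction eq x≢z
triple-injective x≢y y≢z x≢z {suc zero}       {zero}           eq = contradiction (sym eq) x≢y
triple-injective x≢y y≢z x≢z {suc zero}       {suc zero}       _  = refl
triple-injective x≢y y≢z x≢z {suc zero}       {suc (suc zero)} eq = contradiction eq y≢z
triple-injective x≢y y≢z x≢z {suc (suc zero)} {zero}           eq = contradiction (sym eq) x≢z
triple-injective x≢y y≢z x≢z {suc (suc zero)} {suc zero}       eq = contradiction (sym eq) y≢z
triple-injective x≢y y≢z x≢z {suc (suc zero)} {suc (suc zero)} _  = refl

sum-triple : (f : Fin n → ℕ) {x y z : Fin n} → x ≢ y → y ≢ z → x ≢ z → f x + (f y + f z) ≤ sum f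
sum-triple f {x} {y} {z} x≢y y≢z x≢z = ≤-trans (≤-reflexive (sym expand)) (sum-injective-≤ f (triple-injective x≢y y≢z x≢z))
  where
  expand : sum (f ∘ triple x y z) ≡ f x + (f y + f z)
  expand = trans (sum-suc _) (cong (f x +_) (trans (sum-suc _) (cong (f y +_)
    (trans (sum-suc _) (trans (cong (f z +_) (sum-zero _)) (+-identityʳ (f z)))))))

count-≢ : (x : Fin n) → count (λ y → ¬? (x ≟ y)) ≡ n ∸ 1
count-≢ {n} x = sym (trans (cong (_∸ 1) (trans (sym (count-¬ (x ≟_))) (cong (_+ count (λ y → ¬? (x ≟ y)))
  (trans (count-cong (x ≟_) (_≟ x) (λ _ → sym) (λ _ → sym)) (count-≟ x))))) refl)

module Weight {n M : ℕ} (H : Fin M → Subset n) (ω : ℕ → ℕ) where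

  share : Fin M → Fin n → Fin n → ℕ
  share a x y = ⟦ ¬? (x ≟ y) ×-dec joins? H x y a ⟧ * ω (codegree H x y)

  -- The sum is over ordered pairs, so every pair of vertices of the hyperedge counts twice.
  weight : Fin M → ℕ
  weight a = sum (λ x → sum (share a x))

  -- Discharging: a pair of codegree d gives `ω d` to each of its d hyperedges, hence at most K in
  -- all, and there are `n * (n ∸ 1)` ordered pairs.
  total-weight : ∀ {K} → (∀ d → d * ω d ≤ K) → sum weight ≤ n * (n ∸ 1) * K
  total-weight {K} capacity = begin
    sum weight                                        ≡⟨ ∑-comm (λ a x → sum (share a x)) ⟩
    sum (λ x → sum (λ a → sum (share a x)))           ≡⟨ sum-cong-≗ (λ x → ∑-comm (λ a y → share a x y)) ⟩
    sum (λ x → sum (λ y → sum (λ a → share a x y)))   ≤⟨ sum-mono (λ x → sum-mono (pair x)) ⟩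
    sum (λ x → sum (λ y → ⟦ ¬? (x ≟ y) ⟧ * K))        ≡⟨ sum-cong-≗ row-total ⟩
    sum {n} (λ _ → (n ∸ 1) * K)                       ≡⟨ sum-const n ((n ∸ 1) * K) ⟩
    n * ((n ∸ 1) * K)                                 ≡⟨ *-assoc n (n ∸ 1) K ⟨
    n * (n ∸ 1) * K                                   ∎
    where
    open ≤-Reasoning
    row-total : ∀ x → sum (λ y → ⟦ ¬? (x ≟ y) ⟧ * K) ≡ (n ∸ 1) * K
    row-total x = trans (sym (*-distribʳ-sum K (λ y → ⟦ ¬? (x ≟ y) ⟧))) (cong (_* K) (count-≢ {n} x))
    pair : ∀ x y → sum (λ a → share a x y) ≤ ⟦ ¬? (x ≟ y) ⟧ * K
    pair x y = ≤-trans (≤-reflexive (sym (*-distribʳ-sum (ω (codegree H x y)) (λ a → ⟦ ¬? (x ≟ y) ×-dec joins? H x y a ⟧)))) bound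
      where
      bound : count (λ a → ¬? (x ≟ y) ×-dec joins? H x y a) * ω (codegree H x y) ≤ ⟦ ¬? (x ≟ y) ⟧ * K
      bound with x ≟ y
      ... | yes p = ≤-reflexive (cong (_* ω (codegree H x y)) (count-none (λ a → ¬? (yes p) ×-dec joins? H x y a) (λ a q → proj₁ q p)))
      ... | no ¬p = ≤-trans (*-monoˡ-≤ (ω (codegree H x y)) (count-mono (λ a → ¬? (no ¬p) ×-dec joins? H x y a) (joins? H x y) (λ _ → proj₂)))
                            (≤-trans (capacity (codegree H x y)) (≤-reflexive (sym (+-identityʳ K))))

  -- The sum defining the weight is restricted to the six ordered pairs of the triple.
  weight-triple : ∀ {a x y z} → x ≢ y → y ≢ z → x ≢ z → x ∈ H a → y ∈ H a → z ∈ H a →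
    2 * (ω (codegree H x y) + ω (codegree H y z) + ω (codegree H x z)) ≤ weight a
  weight-triple {a} {x} {y} {z} x≢y y≢z x≢z x∈a y∈a z∈a = begin
    2 * (ω (codegree H x y) + ω (codegree H y z) + ω (codegree H x z))
      ≡⟨ regroup (ω (codegree H x y)) (ω (codegree H y z)) (ω (codegree H x z)) ⟩
    (ω (codegree H x y) + ω (codegree H x z)) + ((ω (codegree H x y) + ω (codegree H y z)) + (ω (codegree H x z) + ω (codegree H y z)))
      ≤⟨ +-mono-≤ row₁ (+-mono-≤ row₂ row₃) ⟩
    sum (share a x) + (sum (share a y) + sum (share a z))
      ≤⟨ sum-triple (λ u → sum (share a u)) x≢y y≢z x≢z ⟩
    weight a ∎
    where
    open ≤-Reasoning
    regroup : ∀ p q r → 2 * (p + q + r) ≡ (p + r) + ((p + q) + (r + q))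
    regroup = solve-∀
    share-pair : ∀ {u v} → u ≢ v → u ∈ H a → v ∈ H a → share a u v ≡ ω (codegree H u v)
    share-pair {u} {v} u≢v u∈a v∈a =
      trans (cong (_* ω (codegree H u v)) (⟦⟧-true (¬? (u ≟ v) ×-dec joins? H u v a) (u≢v , u∈a , v∈a))) (+-identityʳ _)
    share-pair′ : ∀ {u v} → u ≢ v → u ∈ H a → v ∈ H a → share a v u ≡ ω (codegree H u v)
    share-pair′ {u} {v} u≢v u∈a v∈a = trans (share-pair (≢-sym u≢v) v∈a u∈a) (cong ω (codegree-sym H v u))
    row : ∀ u → share a u x + (share a u y + share a u z) ≤ sum (share a u)
    row u = sum-triple (share a u) x≢y y≢z x≢z
    row₁ : ω (codegree H x y) + ω (codegree H x z) ≤ sum (share a x)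
    row₁ = ≤-trans (≤-reflexive (cong₂ _+_ (sym (share-pair x≢y x∈a y∈a)) (sym (share-pair x≢z x∈a z∈a))))
                   (≤-trans (m≤n+m _ (share a x x)) (row x))
    row₂ : ω (codegree H x y) + ω (codegree H y z) ≤ sum (share a y)
    row₂ = ≤-trans (+-mono-≤ (≤-reflexive (sym (share-pair′ x≢y x∈a y∈a)))
                             (≤-trans (≤-reflexive (sym (share-pair y≢z y∈a z∈a))) (m≤n+m _ (share a y y)))) (row y)
    row₃ : ω (codegree H x z) + ω (codegree H y z) ≤ sum (share a z)
    row₃ = ≤-trans (+-mono-≤ (≤-reflexive (sym (share-pair′ x≢z x∈a z∈a)))
                             (≤-trans (≤-reflexive (sym (share-pair′ y≢z y∈a z∈a))) (m≤m+n _ (share a z z)))) (row z)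

  -- Light refers to codegrees: `ω` is large on small codegrees, so a large weight marks a light
  -- hyperedge.
  light? : ∀ L → Decidable (λ a → L ≤ weight a)
  light? L a = L ≤? weight a

  -- Markov's inequality for the total weight.
  light-few : ∀ L {K} → (∀ d → d * ω d ≤ K) → L * count (light? L) ≤ n * (n ∸ 1) * K
  light-few L capacity = ≤-trans (≤-reflexive (*-distribˡ-sum L (λ a → ⟦ light? L a ⟧)))
    (≤-trans (sum-mono (λ a → ⟦⟧-scale (light? L a) id)) (total-weight capacity))

tier : ℕ → ℕ → ℕ
tier t d with d <? t | d <? t + t
... | yes _ | _     = 3
... | no _  | yes _ = 1
... | no _  | no _  = 0

-- The middle tier requires `2 * t - 1 ≤ 3 * (t - 1)`, which is where `2 ≤ t` enters.
tier-capacity : 2 ≤ t → ∀ d → d * tier t d ≤ 3 * (t ∸ 1)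
tier-capacity {suc (suc u)} (s≤s (s≤s z≤n)) d with d <? suc (suc u) | d <? suc (suc u) + suc (suc u)
... | yes (s≤s d≤) | _ = ≤-trans (*-monoˡ-≤ 3 d≤) (≤-reflexive (*-comm (suc u) 3))
... | no _  | no _  = ≤-trans (≤-reflexive (*-zeroʳ d)) z≤n
... | no _  | yes (s≤s d≤) = begin
  d * 1                     ≡⟨ *-identityʳ d ⟩
  d                         ≤⟨ d≤ ⟩
  suc u + suc (suc u)       ≡⟨ regroup u ⟩
  3 + 2 * u                 ≤⟨ +-monoʳ-≤ 3 (*-monoˡ-≤ u {2} {3} (s≤s (s≤s z≤n))) ⟩
  3 + 3 * u                 ≡⟨ *-suc 3 u ⟨
  3 * suc u                 ∎
  where
  open ≤-Reasoning
  regroup : ∀ u → suc u + suc (suc u) ≡ 3 + 2 * u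
  regroup = solve-∀

-- Heavy hyperedges and apexes

module Heavy {r t n M : ℕ} (3≤r : 3 ≤ r) (H : Fin M → Subset n) (size : ∀ a → ∣ H a ∣ ≡ r) where
  open Weight H (tier t)

  Heavy : Fin M → Set
  Heavy a = ¬ 6 ≤ weight a

  Thick : Fin n → Fin n → Set
  Thick x y = t + t ≤ codegree H x y

  thick-sym : ∀ x y → Thick x y → Thick y x
  thick-sym x y = subst (t + t ≤_) (codegree-sym H x y)

  abstract
    third : ∀ a x y → ∃[ z ] z ∈ H a × z ≢ x × z ≢ y
    third a x y = count-member other? (+-cancelˡ-≤ 2 _ _ (≤-trans 3≤r (≤-trans (≤-reflexive (trans (sym (size a)) (sym (count-∈ (H a)))))
      (≤-trans (count-⊎ (_∈? H a) (_≟ x) (λ z → (z ∈? H a) ×-dec ¬? (z ≟ x)) (λ z z∈a → split z x z∈a))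
      (≤-trans (+-mono-≤ (≤-reflexive (count-≟ x)) (≤-trans (count-⊎ (λ z → (z ∈? H a) ×-dec ¬? (z ≟ x)) (_≟ y) other? (λ z p → split′ z p))
        (+-monoˡ-≤ (count other?) (≤-reflexive (count-≟ y))))) ≤-refl)))))
      where
      Other : Fin n → Set
      Other z = z ∈ H a × z ≢ x × z ≢ y
      other? : Decidable Other
      other? z = (z ∈? H a) ×-dec (¬? (z ≟ x) ×-dec ¬? (z ≟ y))
      split : ∀ z x → z ∈ H a → z ≡ x ⊎ (z ∈ H a × z ≢ x)
      split z x z∈a with z ≟ x
      ... | yes z≡x = inj₁ z≡x
      ... | no z≢x  = inj₂ (z∈a , z≢x)
      split′ : ∀ z → z ∈ H a × z ≢ x → z ≡ y ⊎ Other z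
      split′ z (z∈a , z≢x) with z ≟ y
      ... | yes z≡y = inj₁ z≡y
      ... | no z≢y  = inj₂ (z∈a , z≢x , z≢y)

  tier-light : ∀ {d} → d < t → tier t d ≡ 3
  tier-light {d} d<t with d <? t
  ... | yes _  = refl
  ... | no d≮t = contradiction d<t d≮t

  tier-thin : ∀ {d} → ¬ t + t ≤ d → 1 ≤ tier t d
  tier-thin {d} thin with d <? t | d <? t + t
  ... | yes _ | _     = s≤s z≤n
  ... | no _  | yes _ = s≤s z≤n
  ... | no _  | no ≮  = contradiction (≮⇒≥ ≮) thin

  module _ {a : Fin M} (heavy : Heavy a) where

    abstract
      -- A pair of codegree below `t` has weight 3 in both orders, which alone makes 6; a third
      -- vertex completes it to a triple for `weight-triple`.
      heavy-pair : ∀ {x y} → x ≢ y → Joins H x y a → t ≤ codegree H x y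
      heavy-pair {x} {y} x≢y (x∈a , y∈a) with third a x y
      ... | z , z∈a , z≢x , z≢y = ≮⇒≥ λ light → heavy (≤-trans
        (*-monoʳ-≤ 2 (≤-trans (≤-reflexive (sym (tier-light light))) (≤-trans (m≤m+n _ _) (m≤m+n _ _))))
        (weight-triple x≢y (≢-sym z≢y) (≢-sym z≢x) x∈a y∈a z∈a))

    abstract
      -- Three thin pairs have weight at least 1 each, in both orders, which again makes 6.
      thick-in-triple : ∀ {x y z} → x ≢ y → y ≢ z → x ≢ z → x ∈ H a → y ∈ H a → z ∈ H a →
                        Thick x y ⊎ Thick y z ⊎ Thick x z
      thick-in-triple {x} {y} {z} x≢y y≢z x≢z x∈a y∈a z∈a
        with t + t ≤? codegree H x y | t + t ≤? codegree H y z | t + t ≤? codegree H x z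
      ... | yes thick | _         | _         = inj₁ thick
      ... | no _      | yes thick | _         = inj₂ (inj₁ thick)
      ... | no _      | no _      | yes thick = inj₂ (inj₂ thick)
      ... | no thin₁  | no thin₂  | no thin₃  = contradiction (≤-trans
        (*-monoʳ-≤ 2 (+-mono-≤ (+-mono-≤ (tier-thin thin₁) (tier-thin thin₂)) (tier-thin thin₃)))
        (weight-triple x≢y y≢z x≢z x∈a y∈a z∈a)) heavy

    abstract
      thick-pair : ∃[ x ] ∃[ y ] x ≢ y × Joins H x y a × Thick x y
      thick-pair with distinct-members {q = 1} (_∈? H a) (≤-trans (≤-trans (s≤s z≤n) 3≤r) (≤-reflexive (trans (sym (size a)) (sym (count-∈ (H a))))))
      ... | f , _ , f∈a with f zero | f∈a zero
      -- With x given twice, `third` provides a second vertex.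
      ... | x | x∈a with third a x x
      ... | y , y∈a , y≢x , _ with third a x y
      ... | z , z∈a , z≢x , z≢y with thick-in-triple (≢-sym y≢x) (≢-sym z≢y) (≢-sym z≢x) x∈a y∈a z∈a
      ... | inj₁ thick        = x , y , ≢-sym y≢x , (x∈a , y∈a) , thick
      ... | inj₂ (inj₁ thick) = y , z , ≢-sym z≢y , (y∈a , z∈a) , thick
      ... | inj₂ (inj₂ thick) = x , z , ≢-sym z≢x , (x∈a , z∈a) , thick

  -- The edge xy can be replaced by the path x z y: choosing t hyperedges for yz first leaves t for xz.
  Apex : Fin n → Fin n → Fin n → Set
  Apex x y z = z ≢ x × z ≢ y × t ≤ codegree H y z × Thick x z

  -- A relation on ordered pairs: the apex is required to be thick with the first end.
  Edge : Fin n → Fin n → Set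
  Edge x y = x ≢ y × t ≤ codegree H x y × ∃[ z ] Apex x y z

  edge? : ∀ x y → Dec (Edge x y)
  edge? x y = ¬? (x ≟ y) ×-dec ((t ≤? codegree H x y) ×-dec
    any? (λ z → ¬? (z ≟ x) ×-dec (¬? (z ≟ y) ×-dec ((t ≤? codegree H y z) ×-dec (t + t ≤? codegree H x z)))))

  module _ {a : Fin M} (heavy : Heavy a) where

    apex⇒edge : ∀ {x y z} → x ≢ y → z ≢ x → z ≢ y → x ∈ H a → y ∈ H a → z ∈ H a → Thick x z → Edge x y
    apex⇒edge x≢y z≢x z≢y x∈a y∈a z∈a thick =
      x≢y , heavy-pair heavy x≢y (x∈a , y∈a) , _ , z≢x , z≢y , heavy-pair heavy (≢-sym z≢y) (y∈a , z∈a) , thick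

    abstract
      contains-edge : ∃[ x ] ∃[ y ] Edge x y × Joins H x y a
      contains-edge = from-thick (thick-pair heavy)
        where
        from-thick : (∃[ x ] ∃[ z ] x ≢ z × Joins H x z a × Thick x z) → ∃[ x ] ∃[ y ] Edge x y × Joins H x y a
        from-thick (x , z , x≢z , (x∈a , z∈a) , thick) with third a x z
        ... | y , y∈a , y≢x , y≢z =
          x , y , apex⇒edge {x} {y} {z} (≢-sym y≢x) (≢-sym x≢z) (≢-sym y≢z) x∈a y∈a z∈a thick , x∈a , y∈a

    abstract
      -- Let xz be a thick pair of the hyperedge. If c is x or z, the other end of xz is an apex of
      -- cd. Otherwise cx is thick, and then x is an apex of cd, or cx is thin, and then z is an
      -- apex of xc.
      thin-edge : ∀ {c d} → c ≢ d → Joins H c d a → ¬ Thick c d →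
                  ∃[ x ] ∃[ y ] Edge x y × Joins H x y a × ¬ Thick x y
      thin-edge {c} {d} c≢d (c∈a , d∈a) thin = from-thick (thick-pair heavy)
        where
        from-thick : (∃[ x ] ∃[ z ] x ≢ z × Joins H x z a × Thick x z) →
                     ∃[ x ] ∃[ y ] Edge x y × Joins H x y a × ¬ Thick x y
        from-thick (x , z , x≢z , (x∈a , z∈a) , thick) with c ≟ x | c ≟ z
        ... | yes refl | _ =
          c , d , apex⇒edge {c} {d} {z} c≢d (≢-sym x≢z) (λ { refl → thin thick }) c∈a d∈a z∈a thick , (c∈a , d∈a) , thin
        ... | no _ | yes refl =
          c , d , apex⇒edge {c} {d} {x} c≢d x≢z (λ { refl → thin (thick-sym x z thick) }) c∈a d∈a x∈a (thick-sym x z thick) ,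
          (c∈a , d∈a) , thin
        ... | no c≢x | no c≢z with t + t ≤? codegree H c x
        ...   | no thin′ =
          x , c , apex⇒edge {x} {c} {z} (≢-sym c≢x) (≢-sym x≢z) (≢-sym c≢z) x∈a c∈a z∈a thick , (x∈a , c∈a) ,
          λ thick′ → thin′ (thick-sym x c thick′)
        ...   | yes thick′ =
          c , d , apex⇒edge {c} {d} {x} c≢d (≢-sym c≢x) (λ { refl → thin thick′ }) c∈a d∈a x∈a thick′ , (c∈a , d∈a) , thin

-- A cycle in a family of large codegrees

abstract
  differing-element : (p q : Subset n) → p ≢ q → ∃[ x ] ((x ∈ p × ¬ x ∈ q) ⊎ (x ∈ q × ¬ x ∈ p))
  differing-element p q p≢q with any? (λ x → (x ∈? p) ×-dec ¬? (x ∈? q)) | any? (λ x → (x ∈? q) ×-dec ¬? (x ∈? p))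
  ... | yes (x , d) | _           = x , inj₁ d
  ... | no _        | yes (x , d) = x , inj₂ d
  ... | no p⊆q      | no q⊆p      = contradiction
    (⊆-antisym (λ {x} x∈p → decidable-stable (x ∈? q) (λ x∉q → p⊆q (x , x∈p , x∉q)))
               (λ {x} x∈q → decidable-stable (x ∈? p) (λ x∉p → q⊆p (x , x∈q , x∉p)))) p≢q
  
-- The three bounds on `T` serve, in this order, to find new vertices, to show that all pairs in
-- members are thick, and to select the hyperedges of the whole cycle at the end.
module CoreCycle {r t n M m T : ℕ} (3≤r : 3 ≤ r) (H : Fin M → Subset n) (size : ∀ a → ∣ H a ∣ ≡ r)
  (H-injective : Injective _≡_ _≡_ H) (1≤m : 1 ≤ m) (2^m<T : 2 ^ m < T) (2t≤T : t + t ≤ T) (ℓt≤T : suc m * t ≤ T)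
  (core : Core (joins? H) T (Heavy.Heavy {r} {t} 3≤r H size) (Heavy.Edge {r} {t} 3≤r H size)) where
  open Heavy {r} {t} 3≤r H size
  open Core core

  popular≤codegree : ∀ x y → count (λ b → member? b ×-dec joins? H x y b) ≤ codegree H x y
  popular≤codegree x y = count-mono (λ b → member? b ×-dec joins? H x y b) (joins? H x y) (λ _ → proj₂)

  abstract
    -- A thin pair would yield a thin edge in the same member, but edges in members of the core have
    -- codegree at least `T`.
    all-thick : ∀ a x y → Member a → x ≢ y → Joins H x y a → Thick x y
    all-thick a x y mem x≢y joins with t + t ≤? codegree H x y
    ... | yes thick = thick
    ... | no thin with thin-edge {a} (member⊆ mem) {x} {y} x≢y joins thin
    ...   | u , v , edge , joins′ , thin′ =
      contradiction (≤-trans 2t≤T (≤-trans (popular {_} {u} {v} mem edge joins′) (popular≤codegree u v))) thin′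

  abstract
    -- As all pairs of a member are thick, every third vertex is an apex, so every pair is an edge
    -- and the core condition applies to it.
    popular-pair : ∀ a x y → Member a → x ≢ y → Joins H x y a → T ≤ count (λ b → member? b ×-dec joins? H x y b)
    popular-pair a x y mem x≢y (x∈a , y∈a) with third a x y
    ... | z , z∈a , z≢x , z≢y = popular {a} {x} {y} mem
      (apex⇒edge {a} (member⊆ mem) {x} {y} {z} x≢y z≢x z≢y x∈a y∈a z∈a (all-thick a x z mem (≢-sym z≢x) (x∈a , z∈a))) (x∈a , y∈a)

  Covered : Fin n → Fin n → Set
  Covered x y = x ≢ y × ∃[ a ] Member a × Joins H x y a

  covered⇒codegree : ∀ x y → Covered x y → T ≤ codegree H x y
  covered⇒codegree x y (x≢y , a , mem , joins) = ≤-trans (popular-pair a x y mem x≢y joins) (popular≤codegree x y)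

  -- More than 2^q members contain u and v, so two of them agree on the q used vertices and differ elsewhere.
  abstract
    new-vertex : ∀ {q} u v → Covered u v → (used : Fin q → Fin n) → 2 ^ q < T →
                 ∃[ x ] (∀ i → used i ≢ x) × ∃[ a ] Member a × Joins H u v a × x ∈ H a
    new-vertex {q} u v (u≢v , a₀ , mem₀ , joins₀) used 2^q<T = from-collision collision
      where
      many : Σ (Fin T → Fin M) λ f → Injective _≡_ _≡_ f × (∀ i → Member (f i) × Joins H u v (f i))
      many = distinct-members (λ b → member? b ×-dec joins? H u v b) (popular-pair a₀ u v mem₀ u≢v joins₀)
      f : Fin T → Fin M
      f = proj₁ many
      trace? : ∀ j → Decidable (λ i → used i ∈ H (f j))
      trace? j i = used i ∈? H (f j)
      collision : ∃[ i ] ∃[ j ] toℕ i < toℕ j × pattern-code (trace? i) ≡ pattern-code (trace? j)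
      collision = pigeonhole 2^q<T (λ j → pattern-code (trace? j))
      avoid : ∀ i j {x} → pattern-code (trace? i) ≡ pattern-code (trace? j) → x ∈ H (f i) → ¬ x ∈ H (f j) → ∀ k → used k ≢ x
      avoid i j eq x∈ x∉ k refl = x∉ (pattern-code-≡ (trace? i) (trace? j) eq k x∈)
      from-collision : (∃[ i ] ∃[ j ] toℕ i < toℕ j × pattern-code (trace? i) ≡ pattern-code (trace? j)) →
                       ∃[ x ] (∀ i → used i ≢ x) × ∃[ a ] Member a × Joins H u v a × x ∈ H a
      from-collision (i , j , i<j , eq) with differing-element (H (f i)) (H (f j))
        (λ same → <⇒≢ i<j (cong toℕ (proj₁ (proj₂ many) {i} {j} (H-injective same))))
      ... | x , inj₁ (x∈ , x∉) = x , avoid i j eq x∈ x∉ , f i , proj₁ (proj₂ (proj₂ many) i) , proj₂ (proj₂ (proj₂ many) i) , x∈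
      ... | x , inj₂ (x∈ , x∉) = x , avoid j i (sym eq) x∈ x∉ , f j , proj₁ (proj₂ (proj₂ many) j) , proj₂ (proj₂ (proj₂ many) j) , x∈

  -- A cycle through covered pairs, cut open at `closing`.
  record Chain (q : ℕ) : Set where
    field
      vertex    : Fin (suc q) → Fin n
      injective : Injective _≡_ _≡_ vertex
      links     : ∀ j → Covered (vertex (inject₁ j)) (vertex (suc j))
      closing   : Covered (vertex zero) (vertex (fromℕ q))

  Covered-sym : ∀ x y → Covered x y → Covered y x
  Covered-sym x y (x≢y , a , mem , joins) = ≢-sym x≢y , a , mem , Joins-sym H joins

  -- At the start a single pair is both the only link and the closing pair. Then a member containing
  -- the closing pair provides a new vertex, which is put in front: its pair with the old first
  -- vertex is a link, and its pair with the last vertex is the new closing pair.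
  chain : ∀ q → suc q ≤ m → Chain (suc q)
  chain zero _ = start (nonempty)
    where
    start : ∃ Member → Chain 1
    start (a , mem) with thick-pair (member⊆ mem)
    ... | x , y , x≢y , joins , _ = record
      { vertex = w ; injective = w-inj ; links = λ { zero → cov } ; closing = cov }
      where
      cov : Covered x y
      cov = x≢y , a , mem , joins
      w : Fin 2 → Fin n
      w zero       = x
      w (suc zero) = y
      w-inj : Injective _≡_ _≡_ w
      w-inj {zero}     {zero}     _  = refl
      w-inj {zero}     {suc zero} eq = contradiction eq x≢y
      w-inj {suc zero} {zero}     eq = contradiction (sym eq) x≢y
      w-inj {suc zero} {suc zero} _  = refl
  chain (suc q) q<m = extend (chain q (<⇒≤ q<m))
    where
    extend : Chain (suc q) → Chain (suc (suc q))
    extend c with new-vertex {suc (suc q)} _ _ (Chain.closing c) (Chain.vertex c) (≤-<-trans (^-monoʳ-≤ 2 q<m) 2^m<T)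
    ... | x , fresh , a , mem , (first∈a , last∈a) , x∈a = record
      { vertex = w ; injective = w-inj ; links = links⁺ ; closing = ≢-sym (fresh (fromℕ (suc q))) , a , mem , x∈a , last∈a }
      where
      module C = Chain c
      w : Fin (suc (suc (suc q))) → Fin n
      w zero    = x
      w (suc i) = C.vertex i
      w-inj : Injective _≡_ _≡_ w
      w-inj {zero}  {zero}  _  = refl
      w-inj {zero}  {suc j} eq = contradiction (sym eq) (fresh j)
      w-inj {suc i} {zero}  eq = contradiction eq (fresh i)
      w-inj {suc i} {suc j} eq = cong suc (C.injective eq)
      links⁺ : ∀ j → Covered (w (inject₁ j)) (w (suc j))
      links⁺ zero    = ≢-sym (fresh zero) , a , mem , x∈a , first∈a
      links⁺ (suc j) = C.links j

  core-cycle : BergeIn t (Cycle (suc m)) n M H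
  core-cycle = from-chain (full-chain 1≤m ≤-refl)
    where
    full-chain : ∀ {q} → 1 ≤ q → q ≤ m → Chain q
    full-chain {suc q} _ q≤m = chain q q≤m
    from-chain : Chain m → BergeIn t (Cycle (suc m)) n M H
    from-chain c = C.vertex , C.injective , (λ f s → proj₁ reps (combine f s)) ,
      (λ f {s} {s′} eq → combine-injectiveʳ f s f s′ (proj₁ (proj₂ reps) eq)) ,
      (λ f f′ s s′ eq → combine-injectiveˡ f s f′ s′ (proj₁ (proj₂ reps) eq)) ,
      λ f s → subst (λ fs → Joins H (C.vertex (proj₁ fs)) (C.vertex (nextF (proj₁ fs))) (proj₁ reps (combine f s)))
                    (remQuot-combine f s) (proj₂ (proj₂ reps) (combine f s))
      where
      module C = Chain c
      covered : ∀ f → Covered (C.vertex f) (C.vertex (nextF f))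
      covered f with view f
      ... | ‵fromℕ     rewrite nextF-fromℕ m   = Covered-sym _ _ C.closing
      ... | ‵inject₁ j rewrite nextF-inject₁ j = C.links j
      edge : Fin (suc m * t) → Fin (suc m)
      edge i = proj₁ (remQuot t i)
      -- The `t` hyperedges for all edges are chosen at once, indexed by edge and slot; a single
      -- injection then makes the bundles disjoint.
      reps : Σ (Fin (suc m * t) → Fin M) λ g → Injective _≡_ _≡_ g ×
             (∀ i → Joins H (C.vertex (edge i)) (C.vertex (nextF (edge i))) (g i))
      reps = distinct-representatives (λ i → joins? H (C.vertex (edge i)) (C.vertex (nextF (edge i))))
        (λ i → ≤-trans (toℕ<n i) (≤-trans ℓt≤T (covered⇒codegree _ _ (covered (edge i)))))

-- Cycles in a dense graph of pairs

⟦⟧-× : {P Q : Set} (p? : Dec P) (q? : Dec Q) → ⟦ p? ×-dec q? ⟧ ≡ ⟦ p? ⟧ * ⟦ q? ⟧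
⟦⟧-× (no _)  _  = refl
⟦⟧-× (yes _) q? = sym (+-identityʳ ⟦ q? ⟧)

count₂-× : {P Q : Fin n → Set} (P? : Decidable P) (Q? : Decidable Q) →
           count₂ (λ x y → P? x ×-dec Q? y) ≡ count P? * count Q?
count₂-× P? Q? = trans (sum-cong-≗ row) (sym (*-distribʳ-sum (count Q?) (λ x → ⟦ P? x ⟧)))
  where
  row : ∀ x → count (λ y → P? x ×-dec Q? y) ≡ ⟦ P? x ⟧ * count Q?
  row x = trans (sum-cong-≗ (λ y → ⟦⟧-× (P? x) (Q? y))) (sym (*-distribˡ-sum ⟦ P? x ⟧ (λ y → ⟦ Q? y ⟧)))

-- Disjoint bundles and the replacement of an edge

module GraphCycle {r t n M : ℕ} (3≤r : 3 ≤ r) (1≤t : 1 ≤ t) (H : Fin M → Subset n) (size : ∀ a → ∣ H a ∣ ≡ r) (a₀ : Fin M) where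
  open Heavy {r} {t} 3≤r H size

  abstract
    -- `a₀` is a default value for pairs of codegree below `t`, so that bundles are defined for all
    -- pairs.
    bundle : ∀ x y → Σ (Fin t → Fin M) λ h → t ≤ codegree H x y → Injective _≡_ _≡_ h × (∀ s → Joins H x y (h s))
    bundle x y with t ≤? codegree H x y
    ... | no few = (λ _ → a₀) , λ many → contradiction many few
    ... | yes many with distinct-members (joins? H x y) many
    ...   | h , h-inj , joins = h , λ _ → h-inj , joins

  h : Fin n → Fin n → Fin t → Fin M
  h x y = proj₁ (bundle x y)

  -- A hyperedge common to the bundles of two edges would be a hit in both directions, so excluding
  -- one direction makes the bundles disjoint.
  Hit : (x y x′ y′ : Fin n) → Set
  Hit x y x′ y′ = ∃[ s ] Joins H x′ y′ (h x y s)

  hit? : ∀ x y x′ y′ → Dec (Hit x y x′ y′)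
  hit? x y x′ y′ = any? (λ s → joins? H x′ y′ (h x y s))

  -- Each of the `t` hyperedges of the bundle contains `r * r` ordered pairs.
  hit-few : ∀ x y → count₂ (hit? x y) ≤ t * (r * r)
  hit-few x y = begin
    count₂ (hit? x y)                                           ≤⟨ sum-mono (λ x′ → count-any (λ s y′ → joins? H x′ y′ (h x y s))) ⟩
    sum (λ x′ → sum (λ s → count (λ y′ → joins? H x′ y′ (h x y s))))  ≡⟨ ∑-comm (λ x′ s → count (λ y′ → joins? H x′ y′ (h x y s))) ⟩
    sum (λ s → count₂ (λ x′ y′ → joins? H x′ y′ (h x y s)))      ≡⟨ sum-cong-≗ (λ s → count₂-× (_∈? H (h x y s)) (_∈? H (h x y s))) ⟩
    sum (λ s → count (_∈? H (h x y s)) * count (_∈? H (h x y s)))  ≤⟨ sum-≤ (λ s → ≤-reflexive (cong₂ _*_ (∈-size (h x y s)) (∈-size (h x y s)))) ⟩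
    t * (r * r)                                                 ∎
    where
    open ≤-Reasoning
    ∈-size : ∀ a → count (_∈? H a) ≡ r
    ∈-size a = trans (count-∈ (H a)) (size a)

  abstract
    disjointEdges : Independent hit? (t * (r * r)) Edge (count₂ edge?)
    disjointEdges = independent-subset hit? (t * (r * r)) _ edge? ≤-refl self (λ {x} {y} _ → hit-few x y)
      where
      self : ∀ {x y} → Edge x y → Hit x y x y
      self {x} {y} (_ , many , _) = fromℕ< 1≤t , proj₂ (proj₂ (bundle x y) many) (fromℕ< 1≤t)

  open Independent disjointEdges public using (Chosen; chosen?; chosen⊆; separate; large)

  h-injective : ∀ {x y} → Chosen x y → Injective _≡_ _≡_ (h x y)
  h-injective {x} {y} ch = proj₁ (proj₂ (bundle x y) (proj₁ (proj₂ (chosen⊆ ch))))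

  h-joins : ∀ {x y} → Chosen x y → ∀ s → Joins H x y (h x y s)
  h-joins {x} {y} ch = proj₂ (proj₂ (bundle x y) (proj₁ (proj₂ (chosen⊆ ch))))

  h-disjoint : ∀ {x y x′ y′} → Chosen x y → Chosen x′ y′ → ∀ s s′ → h x y s ≡ h x′ y′ s′ → x ≡ x′ × y ≡ y′
  h-disjoint {x} {y} {x′} {y′} ch ch′ s s′ eq with separate ch ch′
  ... | inj₁ same         = same
  ... | inj₂ (inj₁ ¬hit) = contradiction (s , subst (Joins H x′ y′) (sym eq) (h-joins ch′ s′)) ¬hit
  ... | inj₂ (inj₂ ¬hit) = contradiction (s′ , subst (Joins H x y) eq (h-joins ch s)) ¬hit

  -- On each side index `zero` is reserved for an end of the edge xy that may be replaced. The
  -- hyperedges of the detour contain at most `(t + t) * r` vertices, which leaves at least `m`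
  -- usable ones.
  module _ {m : ℕ} (2≤m : 2 ≤ m) (even : isEven (suc m) ≡ true) (K : CompleteBipartite (suc (m + (t + t) * r)) Chosen) where
    open CompleteBipartite K

    S : ℕ
    S = suc (m + (t + t) * r)

    x y z : Fin n
    x = left zero
    y = right zero

    abstract
      apex : ∃[ z ] Apex x y z
      apex = proj₂ (proj₂ (chosen⊆ (complete zero zero)))

    z = proj₁ apex

    abstract
      detour : Σ (Fin (t + t) → Fin M) λ f → Injective _≡_ _≡_ f ×
               (∀ s → Joins H y z (f (s ↑ˡ t))) × (∀ s → Joins H x z (f (t ↑ʳ s)))
      detour = f , proj₁ (proj₂ reps) ,
        (λ s → subst (λ k → Side k (f (s ↑ˡ t))) (splitAt-↑ˡ t s t) (proj₂ (proj₂ reps) (s ↑ˡ t))) ,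
        (λ s → subst (λ k → Side k (f (t ↑ʳ s))) (splitAt-↑ʳ t t s) (proj₂ (proj₂ reps) (t ↑ʳ s)))
        where
        Side : Fin t ⊎ Fin t → Fin M → Set
        Side (inj₁ _) = Joins H y z
        Side (inj₂ _) = Joins H x z
        side? : ∀ k → Decidable (Side k)
        side? (inj₁ _) = joins? H y z
        side? (inj₂ _) = joins? H x z
        -- The first `t` indices belong to yz, whose codegree is at least `t`; the others are below
        -- `t + t`, within the codegree of the thick pair xz.
        enough : ∀ i → toℕ i < count (side? (splitAt t i))
        enough i with splitAt t i in eq
        ... | inj₁ j = ≤-trans (subst (_< t) (trans (sym (Finₚ.toℕ-↑ˡ j t)) (cong toℕ (Finₚ.splitAt⁻¹-↑ˡ eq))) (toℕ<n j))
                               (proj₁ (proj₂ (proj₂ (proj₂ apex))))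
        ... | inj₂ j = ≤-trans (toℕ<n i) (proj₂ (proj₂ (proj₂ (proj₂ apex))))
        reps : Σ (Fin (t + t) → Fin M) λ f → Injective _≡_ _≡_ f × (∀ i → Side (splitAt t i) (f i))
        reps = distinct-representatives (λ i → side? (splitAt t i)) enough
        f : Fin (t + t) → Fin M
        f = proj₁ reps

    f : Fin (t + t) → Fin M
    f = proj₁ detour

    -- A link with an untouched end uses no hyperedge of the detour. The vertices x, y and z are
    -- touched, hence differ from all untouched ones.
    Touched : Fin n → Set
    Touched v = ∃[ u ] v ∈ H (f u)

    touched? : Decidable Touched
    touched? v = any? (λ u → v ∈? H (f u))

    abstract
      untouched : (g : Fin S → Fin n) → Injective _≡_ _≡_ g →
                  Σ (Fin m → Fin S) λ α → Injective _≡_ _≡_ α × (∀ i → ¬ Touched (g (α i)))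
      untouched g g-inj = distinct-members (λ i → ¬? (touched? (g i))) (+-cancelˡ-≤ ((t + t) * r) _ _ (begin
        (t + t) * r + m                                                      ≡⟨ +-comm ((t + t) * r) m ⟩
        m + (t + t) * r                                                      ≤⟨ n≤1+n _ ⟩
        S                                                                    ≡⟨ count-¬ (λ i → touched? (g i)) ⟨
        count (λ i → touched? (g i)) + count (λ i → ¬? (touched? (g i)))     ≤⟨ +-monoˡ-≤ _ (begin
          count (λ i → touched? (g i))                ≤⟨ sum-injective-≤ (λ v → ⟦ touched? v ⟧) g-inj ⟩
          count touched?                              ≤⟨ count-any (λ u v → v ∈? H (f u)) ⟩
          sum (λ u → count (_∈? H (f u)))             ≤⟨ sum-≤ (λ u → ≤-reflexive (trans (count-∈ (H (f u))) (size (f u)))) ⟩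
          (t + t) * r                                 ∎) ⟩
        (t + t) * r + count (λ i → ¬? (touched? (g i)))                      ∎))
        where open ≤-Reasoning

    s₀ : Fin t
    s₀ = fromℕ< 1≤t

    x-touched : Touched x
    x-touched = _ , proj₁ (proj₂ (proj₂ (proj₂ detour)) s₀)

    y-touched : Touched y
    y-touched = _ , proj₁ (proj₁ (proj₂ (proj₂ detour)) s₀)

    z-touched : Touched z
    z-touched = _ , proj₂ (proj₁ (proj₂ (proj₂ detour)) s₀)

    freshLeft : Σ (Fin m → Fin S) λ α → Injective _≡_ _≡_ α × (∀ i → ¬ Touched (left (α i)))
    freshLeft = untouched left left-injective

    freshRight : Σ (Fin m → Fin S) λ β → Injective _≡_ _≡_ β × (∀ i → ¬ Touched (right (β i)))
    freshRight = untouched right right-injective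

    -- x goes to position zero and, by `rightIndex`, y to the last position, so that the closing
    -- edge of the alternating cycle is xy.
    leftIndex : Fin (suc m) → Fin S
    leftIndex zero    = zero
    leftIndex (suc i) = proj₁ freshLeft i

    rightIndex : Fin (suc m) → Fin S
    rightIndex = proj₁ freshRight ∷ʳ zero

    a b : Fin (suc m) → Fin n
    a = left ∘ leftIndex
    b = right ∘ rightIndex

    a-fresh : ∀ i → i ≡ zero ⊎ ¬ Touched (a i)
    a-fresh zero    = inj₁ refl
    a-fresh (suc i) = inj₂ (proj₂ (proj₂ freshLeft) i)

    b-fresh : ∀ i → i ≡ fromℕ m ⊎ ¬ Touched (b i)
    b-fresh i with view i
    ... | ‵fromℕ     = inj₁ refl
    ... | ‵inject₁ j = inj₂ (proj₂ (proj₂ freshRight) j)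

    b-last : b (fromℕ m) ≡ y
    b-last = cong right (∷ʳ-last (proj₁ freshRight) zero)

    a-injective : Injective _≡_ _≡_ a
    a-injective {zero}  {zero}  _  = refl
    a-injective {zero}  {suc j} eq = contradiction (subst Touched eq x-touched) (proj₂ (proj₂ freshLeft) j)
    a-injective {suc i} {zero}  eq = contradiction (subst Touched (sym eq) x-touched) (proj₂ (proj₂ freshLeft) i)
    a-injective {suc i} {suc j} eq = cong suc (proj₁ (proj₂ freshLeft) {i} {j} (left-injective eq))

    b-injective : Injective _≡_ _≡_ b
    b-injective {i} {j} eq with view i | view j
    ... | ‵fromℕ      | ‵fromℕ      = refl
    ... | ‵fromℕ      | ‵inject₁ j′ = contradiction (subst Touched eq y-touched) (proj₂ (proj₂ freshRight) j′)
    ... | ‵inject₁ i′ | ‵fromℕ      = contradiction (subst Touched (sym eq) y-touched) (proj₂ (proj₂ freshRight) i′)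
    ... | ‵inject₁ i′ | ‵inject₁ j′ = cong inject₁ (proj₁ (proj₂ freshRight) {i′} {j′} (right-injective eq))

    open Alternating 2≤m even a b

    chosen : ∀ i j → Chosen (a i) (b j)
    chosen i j = complete (leftIndex i) (rightIndex j)

    vertices-distinct : Injective _≡_ _≡_ vertex
    vertices-distinct = vertex-injective (λ {i} {j} → a-injective {i} {j}) (λ {i} {j} → b-injective {i} {j}) (λ i j → proj₁ (chosen⊆ (chosen i j)))

    link : Fin (suc m) → Fin t → Fin M
    link j = h (a (inA j)) (b (inB j))

    link-chosen : ∀ j → Chosen (a (inA j)) (b (inB j))
    link-chosen j = chosen (inA j) (inB j)

    link-joins : ∀ j s → Joins H (vertex j) (vertex (nextF j)) (link j s)
    link-joins j s with h-joins (link-chosen j) s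
    ... | in-a , in-b = edge-ends (_∈ H (link j s)) j in-a in-b

    link-joins-inject₁ : ∀ j s → Joins H (vertex (inject₁ j)) (vertex (suc j)) (link (inject₁ j) s)
    link-joins-inject₁ j s = subst (λ v → Joins H (vertex (inject₁ j)) (vertex v) (link (inject₁ j) s)) (nextF-inject₁ j) (link-joins (inject₁ j) s)

    link-disjoint : ∀ i j s s′ → link i s ≡ link j s′ → i ≡ j
    link-disjoint i j s s′ eq with h-disjoint (link-chosen i) (link-chosen j) s s′ eq
    ... | eqA , eqB = edge-injective i j (a-injective {inA i} {inA j} eqA) (b-injective {inB i} {inB j} eqB)

    even-cycle : BergeIn t (Cycle (suc m)) n M H
    even-cycle = berge-cycle H vertex (λ {i} {j} → vertices-distinct {i} {j}) (link ∘ inject₁) (link (fromℕ m))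
      link-joins-inject₁
      (λ s → subst (λ v → Joins H (vertex (fromℕ m)) (vertex v) (link (fromℕ m) s)) (nextF-fromℕ m) (link-joins (fromℕ m) s))
      (λ j → h-injective (link-chosen (inject₁ j)))
      (h-injective (link-chosen (fromℕ m)))
      (λ i j s s′ eq → Finₚ.inject₁-injective (link-disjoint (inject₁ i) (inject₁ j) s s′ eq))
      (λ j s s′ eq → fromℕ≢inject₁ (sym (link-disjoint (inject₁ j) (fromℕ m) s s′ eq)))

    -- Only the last link joins two touched vertices, and it is the one that the detour replaces.
    link-avoids-detour : ∀ j s u → link (inject₁ j) s ≢ f u
    link-avoids-detour j s u eq with h-joins (link-chosen (inject₁ j)) s
    ... | in-a , in-b with a-fresh (inA (inject₁ j)) | b-fresh (inB (inject₁ j))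
    ...   | inj₂ fresh | _          = fresh (u , subst (λ e → a (inA (inject₁ j)) ∈ H e) eq in-a)
    ...   | inj₁ _     | inj₂ fresh = fresh (u , subst (λ e → b (inB (inject₁ j)) ∈ H e) eq in-b)
    ...   | inj₁ eqA   | inj₁ eqB   = fromℕ≢inject₁ (sym (edge-injective (inject₁ j) (fromℕ m)
        (trans eqA (sym (proj₁ last-edge))) (trans eqB (sym (proj₂ last-edge)))))

    vertex-last : vertex (fromℕ m) ≡ y
    vertex-last = trans (cong (if_then a (fromℕ m) else b (fromℕ m)) odd-last) b-last

    -- The apex z is put in front of the even cycle: the first link is zx, then follow all links
    -- except xy, and the closing bundle belongs to yz.
    odd-cycle : BergeIn t (Cycle (suc (suc m))) n M H
    odd-cycle = berge-cycle H w (λ {i} {j} → w-inj {i} {j}) g (λ s → f (s ↑ˡ t)) g-joins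
      (λ s → subst (_∈ H (f (s ↑ˡ t))) (sym vertex-last) (proj₁ (proj₁ (proj₂ (proj₂ detour)) s)) , proj₂ (proj₁ (proj₂ (proj₂ detour)) s))
      g-inj (λ eq → ↑ˡ-injective t _ _ (proj₁ (proj₂ detour) eq)) g-disj g-detour
      where
      w : Fin (suc (suc m)) → Fin n
      w zero    = z
      w (suc j) = vertex j
      z≢vertex : ∀ j → z ≢ vertex j
      z≢vertex j eq with isEven (toℕ j)
      z≢vertex j eq | true with a-fresh j
      ... | inj₁ refl  = proj₁ (proj₂ apex) eq
      ... | inj₂ fresh = fresh (subst Touched eq z-touched)
      z≢vertex j eq | false with b-fresh j
      ... | inj₁ refl  = proj₁ (proj₂ (proj₂ apex)) (trans eq b-last)
      ... | inj₂ fresh = fresh (subst Touched eq z-touched)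
      w-inj : Injective _≡_ _≡_ w
      w-inj {zero}  {zero}  _  = refl
      w-inj {zero}  {suc j} eq = contradiction eq (z≢vertex j)
      w-inj {suc i} {zero}  eq = contradiction (sym eq) (z≢vertex i)
      w-inj {suc i} {suc j} eq = cong suc (vertices-distinct {i} {j} eq)
      g : Fin (suc m) → Fin t → Fin M
      g zero    s = f (t ↑ʳ s)
      g (suc j) s = link (inject₁ j) s
      g-joins : ∀ j s → Joins H (w (inject₁ j)) (w (suc j)) (g j s)
      g-joins zero    s = Joins-sym H (proj₂ (proj₂ (proj₂ detour)) s)
      g-joins (suc j) s = link-joins-inject₁ j s
      g-inj : ∀ j → Injective _≡_ _≡_ (g j)
      g-inj zero    eq = ↑ʳ-injective t _ _ (proj₁ (proj₂ detour) eq)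
      g-inj (suc j) eq = h-injective (link-chosen (inject₁ j)) eq
      g-disj : ∀ i j s s′ → g i s ≡ g j s′ → i ≡ j
      g-disj zero    zero    s s′ eq = refl
      g-disj zero    (suc j) s s′ eq = contradiction (sym eq) (link-avoids-detour j s′ _)
      g-disj (suc i) zero    s s′ eq = contradiction eq (link-avoids-detour i s _)
      g-disj (suc i) (suc j) s s′ eq = cong suc (Finₚ.inject₁-injective (link-disjoint (inject₁ i) (inject₁ j) s s′ eq))
      g-detour : ∀ j s s′ → g j s ≢ f (s′ ↑ˡ t)
      g-detour (suc j) s s′ eq = link-avoids-detour j s _ eq
      g-detour zero    s s′ eq with () ← trans (sym (splitAt-↑ʳ t t s)) (trans (cong (splitAt t) (proj₁ (proj₂ detour) eq)) (splitAt-↑ˡ t s′ t))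

-- Upper bounds

choose₂-suc : ∀ n → suc n C 2 ≡ n + n C 2
choose₂-suc n = trans (sym (nCk+nC[k+1]≡[n+1]C[k+1] n 1)) (cong (_+ n C 2) (nC1≡n n))

2*choose₂ : ∀ n → 2 * (n C 2) ≡ n * (n ∸ 1)
2*choose₂ zero          = refl
2*choose₂ (suc zero)    = refl
2*choose₂ (suc (suc k)) = begin-equality
  2 * (suc (suc k) C 2)              ≡⟨ cong (2 *_) (choose₂-suc (suc k)) ⟩
  2 * (suc k + suc k C 2)            ≡⟨ *-distribˡ-+ 2 (suc k) (suc k C 2) ⟩
  2 * suc k + 2 * (suc k C 2)        ≡⟨ cong (2 * suc k +_) (2*choose₂ (suc k)) ⟩
  2 * suc k + suc k * k              ≡⟨ regroup k ⟩
  suc (suc k) * suc k                ∎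
  where
  open ≤-Reasoning
  regroup : ∀ k → 2 * suc k + suc k * k ≡ suc (suc k) * suc k
  regroup = solve-∀

square≤4*choose₂ : 2 ≤ n → n * n ≤ 4 * (n C 2)
square≤4*choose₂ {suc (suc k)} (s≤s (s≤s z≤n)) = begin
  suc (suc k) * suc (suc k)          ≤⟨ *-monoʳ-≤ (suc (suc k)) (≤-trans (m≤m+n _ k) (≤-reflexive (double k))) ⟩
  suc (suc k) * (2 * suc k)          ≡⟨ regroup (suc (suc k)) (suc k) ⟩
  2 * (suc (suc k) * suc k)          ≡⟨ cong (2 *_) (2*choose₂ (suc (suc k))) ⟨
  2 * (2 * (suc (suc k) C 2))        ≡⟨ *-assoc 2 2 (suc (suc k) C 2) ⟨
  4 * (suc (suc k) C 2)              ∎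
  where
  open ≤-Reasoning
  double : ∀ k → suc (suc k) + k ≡ 2 * suc k
  double = solve-∀
  regroup : ∀ x y → x * (2 * y) ≡ 2 * (x * y)
  regroup = solve-∀

light-bound : ∀ {n M} (H : Fin M → Subset n) → 2 ≤ t →
              count (Weight.light? H (tier t) 6) ≤ (t ∸ 1) * (n C 2)
light-bound {t} {n} H 2≤t = *-cancelˡ-≤ 6 (begin
  6 * count (Weight.light? H (tier t) 6)  ≤⟨ Weight.light-few H (tier t) 6 (tier-capacity 2≤t) ⟩
  n * (n ∸ 1) * (3 * (t ∸ 1))             ≡⟨ cong (_* (3 * (t ∸ 1))) (2*choose₂ n) ⟨
  2 * (n C 2) * (3 * (t ∸ 1))             ≡⟨ regroup (n C 2) (t ∸ 1) ⟩
  6 * ((t ∸ 1) * (n C 2))                 ∎)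
  where
  open ≤-Reasoning
  regroup : ∀ x y → 2 * x * (3 * y) ≡ 6 * (y * x)
  regroup = solve-∀

-- The cycle length `suc m` is the even number `suc k` or one more. A triangle would lead to `suc k`
-- equal to 2, hence `3 ≤ m`.
even-part : 3 ≤ m → ∃[ k ] 2 ≤ k × isEven (suc k) ≡ true × (m ≡ k ⊎ m ≡ suc k)
even-part {suc m} (s≤s 2≤m) with isEven (suc (suc m)) in eq
... | true  = suc m , ≤-trans 2≤m (n≤1+n m) , eq , inj₁ refl
... | false = m , 2≤m , not-injective {isEven (suc m)} {true} eq , inj₂ refl

UpperBound : (r c : ℕ) → ((n M : ℕ) → (Fin M → Subset n) → Set) → Set
UpperBound r c Contains = ∀ d → ∃[ N ] ∀ n → N ≤ n → ∀ M (H : Fin M → Subset n) →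
  Uniform r n M H → ¬ Contains n M H → suc d * M ≤ (c * suc d + 1) * (n C 2)

cycle-upper-bound : ∀ {r t m} → 3 ≤ r → 2 ≤ t → 3 ≤ m → UpperBound r (t ∸ 1) (BergeIn t (Cycle (suc m)))
cycle-upper-bound {r} {t} {m} 3≤r 2≤t 3≤m d with even-part 3≤m
-- The summand 2 ensures `2 ≤ n` for `square≤4*choose₂`.
... | k , 2≤k , even , m-cases = 2 + kővári-sós-turán-threshold D S , λ n N≤n M H uniform → bound n N≤n M H uniform
  where
  T hits D : ℕ
  -- `T` dominates the three quantities in the hypotheses of `CoreCycle`, the first one strictly.
  T = suc (2 ^ m + suc m * t + (t + t))
  hits = t * (r * r)
  -- There are at most `T` heavy hyperedges per edge and at most `hits` edges per chosen pair, so at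
  -- most `n * n / D` chosen pairs leave at most `(n C 2) / suc d` heavy hyperedges. The outer `suc`
  -- makes `D` nonzero.
  D = suc (4 * suc d * (T * hits))
  S : ℕ
  S = suc (k + (t + t) * r)
  bound : ∀ n → 2 + kővári-sós-turán-threshold D S ≤ n → ∀ M (H : Fin M → Subset n) → Uniform r n M H →
          ¬ BergeIn t (Cycle (suc m)) n M H → suc d * M ≤ ((t ∸ 1) * suc d + 1) * (n C 2)
  bound n N≤n zero      H uniform free = subst (_≤ ((t ∸ 1) * suc d + 1) * (n C 2)) (sym (*-zeroʳ (suc d))) z≤n
  -- With a hyperedge present, `zero` can be the default value of the bundles.
  bound n N≤n M@(suc _) H (size , H-inj) free = conclude (core-or-few (joins? H) T _ heavy? edge? ≤-refl (λ _ → contains-edge))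
    where
    open Heavy {r} {t} 3≤r H size
    open Weight H (tier t) using (light?)
    module G = GraphCycle {r} {t} 3≤r (≤-trans (s≤s z≤n) 2≤t) H size zero
    open ≤-Reasoning
    heavy? : Decidable Heavy
    heavy? a = ¬? (light? 6 a)
    cycle : ∀ {j} → j ≡ k ⊎ j ≡ suc k → CompleteBipartite S G.Chosen → BergeIn t (Cycle (suc j)) n M H
    cycle (inj₁ refl) K = G.even-cycle 2≤k even K
    cycle (inj₂ refl) K = G.odd-cycle 2≤k even K
    sparse : D * count₂ G.chosen? ≤ n * n
    sparse with n * n ≤? D * count₂ G.chosen?
    ... | yes dense = contradiction (cycle m-cases (complete-bipartite D S G.chosen? (≤-trans (m≤n+m _ 2) N≤n) dense)) free
    ... | no ¬dense = <⇒≤ (≰⇒> ¬dense)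
    few-heavy : count heavy? ≤ T * count₂ edge? → suc d * count heavy? ≤ n C 2
    few-heavy few = *-cancelˡ-≤ 4 (begin
      4 * (suc d * count heavy?)                       ≤⟨ *-monoʳ-≤ 4 (*-monoʳ-≤ (suc d) few) ⟩
      4 * (suc d * (T * count₂ edge?))                 ≤⟨ *-monoʳ-≤ 4 (*-monoʳ-≤ (suc d) (*-monoʳ-≤ T G.large)) ⟩
      4 * (suc d * (T * (hits * count₂ G.chosen?)))       ≡⟨ regroup (suc d) T hits (count₂ G.chosen?) ⟩
      4 * suc d * (T * hits) * count₂ G.chosen?           ≤⟨ *-monoˡ-≤ (count₂ G.chosen?) (n≤1+n (4 * suc d * (T * hits))) ⟩
      D * count₂ G.chosen?                             ≤⟨ sparse ⟩
      n * n                                            ≤⟨ square≤4*choose₂ (≤-trans (m≤m+n 2 _) N≤n) ⟩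
      4 * (n C 2)                                      ∎)
      where
      regroup : ∀ d T c g → 4 * (d * (T * (c * g))) ≡ 4 * d * (T * c) * g
      regroup = solve-∀
    conclude : Core (joins? H) T Heavy Edge ⊎ count heavy? ≤ T * count₂ edge? →
               suc d * M ≤ ((t ∸ 1) * suc d + 1) * (n C 2)
    conclude (inj₁ core) = contradiction
      (CoreCycle.core-cycle {r} {t} 3≤r H size H-inj (≤-trans (s≤s z≤n) 3≤m)
        (s≤s (≤-trans (m≤m+n (2 ^ m) (suc m * t)) (m≤m+n _ (t + t))))
        (≤-trans (m≤n+m (t + t) (2 ^ m + suc m * t)) (n≤1+n _))
        (≤-trans (m≤n+m (suc m * t) (2 ^ m)) (≤-trans (m≤m+n _ (t + t)) (n≤1+n _))) core) free
    conclude (inj₂ few) = begin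
      suc d * M                                             ≡⟨ cong (suc d *_) (sym (count-¬ (light? 6))) ⟩
      suc d * (count (light? 6) + count heavy?)             ≡⟨ *-distribˡ-+ (suc d) (count (light? 6)) (count heavy?) ⟩
      suc d * count (light? 6) + suc d * count heavy?       ≤⟨ +-mono-≤ (*-monoʳ-≤ (suc d) (light-bound H 2≤t)) (few-heavy few) ⟩
      suc d * ((t ∸ 1) * (n C 2)) + n C 2                   ≡⟨ regroup (suc d) (t ∸ 1) (n C 2) ⟩
      ((t ∸ 1) * suc d + 1) * (n C 2)                       ∎
      where
      regroup : ∀ d u x → d * (u * x) + x ≡ (u * d + 1) * x
      regroup = solve-∀

-- Capacity for the triangle (r = 3, t = 2): a hyperedge lying in two pairs of codegree 2 is charged half to each.
triangleTier : ℕ → ℕ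
triangleTier 0 = 2
triangleTier 1 = 2
triangleTier 2 = 1
triangleTier (suc (suc (suc _))) = 0

triangleTier-capacity : ∀ d → d * triangleTier d ≤ 2
triangleTier-capacity 0 = z≤n
triangleTier-capacity 1 = ≤-refl
triangleTier-capacity 2 = ≤-refl
triangleTier-capacity (suc (suc (suc d))) = ≤-trans (≤-reflexive (*-zeroʳ d)) z≤n

-- The three values add up to at most 1, so at most one codegree equals 2 and the others are at
-- least 3.
triangleTier-sum : ∀ d₁ d₂ d₃ → ¬ 4 ≤ 2 * (triangleTier d₁ + triangleTier d₂ + triangleTier d₃) →
  (2 ≤ d₁ × 3 ≤ d₂ × 3 ≤ d₃) ⊎ (2 ≤ d₂ × 3 ≤ d₁ × 3 ≤ d₃) ⊎ (2 ≤ d₃ × 3 ≤ d₁ × 3 ≤ d₂)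
triangleTier-sum d₁ d₂ d₃ small = go d₁ d₂ d₃ (λ 2≤ → small (*-monoʳ-≤ 2 2≤))
  where
  2≤2+ : ∀ {a} → 2 ≤ 2 + a
  2≤2+ = m≤m+n 2 _
  3≤3+ : ∀ {a} → 3 ≤ 3 + a
  3≤3+ = m≤m+n 3 _
  go : ∀ d₁ d₂ d₃ → ¬ 2 ≤ triangleTier d₁ + triangleTier d₂ + triangleTier d₃ →
    (2 ≤ d₁ × 3 ≤ d₂ × 3 ≤ d₃) ⊎ (2 ≤ d₂ × 3 ≤ d₁ × 3 ≤ d₃) ⊎ (2 ≤ d₃ × 3 ≤ d₁ × 3 ≤ d₂)
  go 0 _ _ small = contradiction 2≤2+ small
  go 1 _ _ small = contradiction 2≤2+ small
  go 2 0 _ small = contradiction (s≤s (s≤s z≤n)) small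
  go 2 1 _ small = contradiction (s≤s (s≤s z≤n)) small
  go 2 2 _ small = contradiction (s≤s (s≤s z≤n)) small
  go 2 (suc (suc (suc _))) 0 small = contradiction (s≤s (s≤s z≤n)) small
  go 2 (suc (suc (suc _))) 1 small = contradiction (s≤s (s≤s z≤n)) small
  go 2 (suc (suc (suc _))) 2 small = contradiction (s≤s (s≤s z≤n)) small
  go 2 (suc (suc (suc _))) (suc (suc (suc _))) small = inj₁ (≤-refl , 3≤3+ , 3≤3+)
  go (suc (suc (suc _))) 0 _ small = contradiction 2≤2+ small
  go (suc (suc (suc _))) 1 _ small = contradiction 2≤2+ small
  go (suc (suc (suc _))) 2 0 small = contradiction (s≤s (s≤s z≤n)) small
  go (suc (suc (suc _))) 2 1 small = contradiction (s≤s (s≤s z≤n)) small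
  go (suc (suc (suc _))) 2 2 small = contradiction (s≤s (s≤s z≤n)) small
  go (suc (suc (suc _))) 2 (suc (suc (suc _))) small = inj₂ (inj₁ (≤-refl , 3≤3+ , 3≤3+))
  go (suc (suc (suc _))) (suc (suc (suc _))) 0 small = contradiction ≤-refl small
  go (suc (suc (suc _))) (suc (suc (suc _))) 1 small = contradiction ≤-refl small
  go (suc (suc (suc _))) (suc (suc (suc _))) (suc (suc d)) small = inj₂ (inj₂ (2≤2+ , 3≤3+ , 3≤3+))

-- Berge triangles in 3-uniform hypergraphs

module TriangleCycle {n M : ℕ} (H : Fin M → Subset n) (size : ∀ a → ∣ H a ∣ ≡ 3) (H-injective : Injective _≡_ _≡_ H) where

  -- An element of `H a` outside `H b` would differ from x, y and z, giving four elements in a set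
  -- of size 3.
  three-points⊆ : ∀ {x y z a b} → x ≢ y → y ≢ z → x ≢ z → (x ∈ H a × y ∈ H a × z ∈ H a) → (x ∈ H b × y ∈ H b × z ∈ H b) →
                  ∀ v → v ∈ H a → v ∈ H b
  three-points⊆ {x} {y} {z} {a} {b} x≢y y≢z x≢z (x∈a , y∈a , z∈a) (x∈b , y∈b , z∈b) v v∈a =
    decidable-stable (v ∈? H b) λ v∉b → <-irrefl refl (begin-strict
      3                                          ≡⟨ cong₂ _+_ (one x x∈a (outside v∉b x∈b)) (cong₂ _+_ (one y y∈a (outside v∉b y∈b)) (one z z∈a (outside v∉b z∈b))) ⟨
      ⟦ rest? x ⟧ + (⟦ rest? y ⟧ + ⟦ rest? z ⟧)  ≤⟨ sum-triple (λ u → ⟦ rest? u ⟧) x≢y y≢z x≢z ⟩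
      count rest?                                <⟨ sum-mono-< (λ u → ⟦⟧-mono (rest? u) (u ∈? H a) proj₁) v
                                                      (subst (_< ⟦ v ∈? H a ⟧) (sym (⟦⟧-false (rest? v) (λ p → proj₂ p refl))) (≤-reflexive (sym (⟦⟧-true (v ∈? H a) v∈a)))) ⟩
      count (_∈? H a)                            ≡⟨ count-∈ (H a) ⟩
      ∣ H a ∣                                    ≡⟨ size a ⟩
      3                                          ∎)
    where
    open ≤-Reasoning
    rest? : Decidable (λ u → u ∈ H a × u ≢ v)
    rest? u = (u ∈? H a) ×-dec ¬? (u ≟ v)
    outside : ¬ v ∈ H b → ∀ {u} → u ∈ H b → u ≢ v
    outside v∉b u∈b refl = v∉b u∈b
    one : ∀ u → u ∈ H a → u ≢ v → ⟦ rest? u ⟧ ≡ 1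
    one u u∈a u≢v = ⟦⟧-true (rest? u) (u∈a , u≢v)

  three-points : ∀ {x y z a b} → x ≢ y → y ≢ z → x ≢ z → (x ∈ H a × y ∈ H a × z ∈ H a) → (x ∈ H b × y ∈ H b × z ∈ H b) → b ≡ a
  three-points {x} {y} {z} {a} {b} x≢y y≢z x≢z in-a in-b = H-injective (⊆-antisym
    (λ {v} → three-points⊆ {x} {y} {z} {b} {a} x≢y y≢z x≢z in-b in-a v)
    (λ {v} → three-points⊆ {x} {y} {z} {a} {b} x≢y y≢z x≢z in-a in-b v))

  others : ∀ {q} a x y → suc q ≤ codegree H x y →
           Σ (Fin q → Fin M) λ g → Injective _≡_ _≡_ g × (∀ s → Joins H x y (g s) × g s ≢ a)
  others a x y many = distinct-members (λ b → joins? H x y b ×-dec ¬? (b ≟ a)) (≤-pred (≤-trans many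
    (≤-trans (count-⊎ (joins? H x y) (_≟ a) (λ b → joins? H x y b ×-dec ¬? (b ≟ a)) split)
             (+-monoˡ-≤ _ (≤-reflexive (count-≟ a))))))
    where
    split : ∀ b → Joins H x y b → b ≡ a ⊎ (Joins H x y b × b ≢ a)
    split b joins with b ≟ a
    ... | yes eq = inj₁ eq
    ... | no ne  = inj₂ (joins , ne)

  -- The pair xy receives `a` and one other hyperedge, while yz and xz receive two hyperedges
  -- different from `a` each. A hyperedge shared by two pairs would contain x, y and z and so be
  -- `a`, which only xy uses.
  triangle : ∀ {a x y z} → x ≢ y → y ≢ z → x ≢ z → x ∈ H a → y ∈ H a → z ∈ H a →
             2 ≤ codegree H x y → 3 ≤ codegree H y z → 3 ≤ codegree H x z → BergeIn 2 (Cycle 3) n M H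
  triangle {a} {x} {y} {z} x≢y y≢z x≢z x∈a y∈a z∈a xy-many yz-many xz-many
    with others a x y xy-many | others a y z yz-many | others a x z xz-many
  ... | g₁ , _ , g₁∈ | g₂ , g₂-inj , g₂∈ | g₃ , g₃-inj , g₃∈ =
    berge-cycle H (triple x y z) (triple-injective x≢y y≢z x≢z) h g₃ h-joins (λ s → Joins-sym H (proj₁ (g₃∈ s)))
      h-inj g₃-inj h-disj hg-disj
    where
    only-a : ∀ {b} → x ∈ H b → y ∈ H b → z ∈ H b → b ≡ a
    only-a x∈b y∈b z∈b = three-points x≢y y≢z x≢z (x∈a , y∈a , z∈a) (x∈b , y∈b , z∈b)
    h : Fin 2 → Fin 2 → Fin M
    h zero       zero    = a
    h zero       (suc s) = g₁ s
    h (suc zero) s       = g₂ s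
    h-joins : ∀ j s → Joins H (triple x y z (inject₁ j)) (triple x y z (suc j)) (h j s)
    h-joins zero       zero    = x∈a , y∈a
    h-joins zero       (suc s) = proj₁ (g₁∈ s)
    h-joins (suc zero) s       = proj₁ (g₂∈ s)
    h-inj : ∀ j → Injective _≡_ _≡_ (h j)
    h-inj zero {zero}     {zero}     _  = refl
    h-inj zero {zero}     {suc s}    eq = contradiction (sym eq) (proj₂ (g₁∈ s))
    h-inj zero {suc s}    {zero}     eq = contradiction eq (proj₂ (g₁∈ s))
    h-inj zero {suc zero} {suc zero} _  = refl
    h-inj (suc zero) eq = g₂-inj eq
    h₀≢g₂ : ∀ s s′ → h zero s ≢ g₂ s′
    h₀≢g₂ s s′ eq = proj₂ (g₂∈ s′) (only-a (subst (λ b → x ∈ H b) eq (proj₁ (h-joins zero s))) (proj₁ (proj₁ (g₂∈ s′))) (proj₂ (proj₁ (g₂∈ s′))))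
    h-disj : ∀ i j s s′ → h i s ≡ h j s′ → i ≡ j
    h-disj zero       zero       _ _  _  = refl
    h-disj zero       (suc zero) s s′ eq = contradiction eq (h₀≢g₂ s s′)
    h-disj (suc zero) zero       s s′ eq = contradiction (sym eq) (h₀≢g₂ s′ s)
    h-disj (suc zero) (suc zero) _ _  _  = refl
    hg-disj : ∀ j s s′ → h j s ≢ g₃ s′
    hg-disj zero s s′ eq = proj₂ (g₃∈ s′) (only-a (proj₁ (proj₁ (g₃∈ s′))) (subst (λ b → y ∈ H b) eq (proj₂ (h-joins zero s))) (proj₂ (proj₁ (g₃∈ s′))))
    hg-disj (suc zero) s s′ eq = proj₂ (g₃∈ s′) (only-a (proj₁ (proj₁ (g₃∈ s′))) (subst (λ b → y ∈ H b) eq (proj₁ (h-joins (suc zero) s))) (proj₂ (proj₁ (g₃∈ s′))))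

-- A hyperedge of weight below 4 yields a triangle, so all hyperedges are light and `M` is at most
-- `n C 2` for every n.
triangle-upper-bound : UpperBound 3 1 (BergeIn 2 (Cycle 3))
triangle-upper-bound d = 0 , λ n _ M H uniform free → bound n M H uniform free
  where
  bound : ∀ n M (H : Fin M → Subset n) → Uniform 3 n M H → ¬ BergeIn 2 (Cycle 3) n M H → suc d * M ≤ (1 * suc d + 1) * (n C 2)
  bound n M H (size , H-inj) free = begin
    suc d * M                        ≤⟨ *-monoʳ-≤ (suc d) (begin
      M                                             ≡⟨ count-¬ (light? 4) ⟨
      count (light? 4) + count (¬? ∘ light? 4)      ≡⟨ cong (count (light? 4) +_) (count-none (¬? ∘ light? 4) no-heavy) ⟩
      count (light? 4) + 0                          ≡⟨ +-identityʳ _ ⟩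
      count (light? 4)                              ≤⟨ *-cancelˡ-≤ 4 (begin
        4 * count (light? 4)                          ≤⟨ light-few 4 triangleTier-capacity ⟩
        n * (n ∸ 1) * 2                               ≡⟨ cong (_* 2) (2*choose₂ n) ⟨
        2 * (n C 2) * 2                               ≡⟨ regroup (n C 2) ⟩
        4 * (n C 2)                                   ∎) ⟩
      n C 2                                         ∎) ⟩
    suc d * (n C 2)                  ≤⟨ *-monoˡ-≤ (n C 2) (≤-trans (≤-reflexive (sym (*-identityˡ (suc d)))) (m≤m+n (1 * suc d) 1)) ⟩
    (1 * suc d + 1) * (n C 2)        ∎
    where
    open ≤-Reasoning
    open Weight H triangleTier
    open TriangleCycle H size H-inj
    regroup : ∀ x → 2 * x * 2 ≡ 4 * x
    regroup = solve-∀
    no-heavy : ∀ a → ¬ ¬ 4 ≤ weight a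
    no-heavy a heavy with distinct-members {q = 3} (_∈? H a) (≤-reflexive (trans (sym (size a)) (sym (count-∈ (H a)))))
    ... | f , f-inj , f∈a = free (build (triangleTier-sum (codegree H x y) (codegree H y z) (codegree H x z)
        (λ big → heavy (≤-trans big (weight-triple x≢y y≢z x≢z (f∈a _) (f∈a _) (f∈a _))))))
      where
      x y z : Fin n
      x = f zero
      y = f (suc zero)
      z = f (suc (suc zero))
      x≢y : x ≢ y
      x≢y eq with () ← f-inj eq
      y≢z : y ≢ z
      y≢z eq with () ← f-inj eq
      x≢z : x ≢ z
      x≢z eq with () ← f-inj eq
      build : (2 ≤ codegree H x y × 3 ≤ codegree H y z × 3 ≤ codegree H x z) ⊎
              (2 ≤ codegree H y z × 3 ≤ codegree H x y × 3 ≤ codegree H x z) ⊎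
              (2 ≤ codegree H x z × 3 ≤ codegree H x y × 3 ≤ codegree H y z) → BergeIn 2 (Cycle 3) n M H
      -- The pair whose codegree may be only 2 is put first, where `triangle` uses the hyperedge `a`
      -- itself.
      build (inj₁ (xy , yz , xz)) = triangle {a} {x} {y} {z} x≢y y≢z x≢z (f∈a _) (f∈a _) (f∈a _) xy yz xz
      build (inj₂ (inj₁ (yz , xy , xz))) = triangle {a} {y} {z} {x} y≢z (≢-sym x≢z) (≢-sym x≢y) (f∈a _) (f∈a _) (f∈a _)
        yz (subst (3 ≤_) (codegree-sym H x z) xz) (subst (3 ≤_) (codegree-sym H x y) xy)
      build (inj₂ (inj₂ (xz , xy , yz))) = triangle {a} {x} {z} {y} x≢z (≢-sym y≢z) x≢y (f∈a _) (f∈a _) (f∈a _)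
        xz (subst (3 ≤_) (codegree-sym H y z) yz) xy

-- Lower bound

triangular : ℕ → ℕ
triangular zero    = 0
triangular (suc m) = m + triangular m

choose₂≡triangular : ∀ n → n C 2 ≡ triangular n
choose₂≡triangular zero    = refl
choose₂≡triangular (suc n) = trans (choose₂-suc n) (cong (n +_) (choose₂≡triangular n))

triangular-+ : ∀ s m → triangular (s + m) ≡ (triangular s + s * m) + triangular m
triangular-+ zero    m = refl
triangular-+ (suc s) m = trans (cong (s + m +_) (triangular-+ s m)) (regroup s m (triangular s) (triangular m))
  where
  regroup : ∀ s m a b → s + m + ((a + s * m) + b) ≡ (s + a + (m + s * m)) + b
  regroup = solve-∀

-- The m pairs of `suc m` vertices that contain `zero` come first, then the pairs of the remaining
-- vertices; the recursion is that of `triangular`.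
pairAt : ∀ m → Fin (triangular m) → Fin m × Fin m
pairAt (suc m) i with splitAt m i
... | inj₁ j = zero , suc j
... | inj₂ k = suc (proj₁ (pairAt m k)) , suc (proj₂ (pairAt m k))

pairAt-< : ∀ m i → toℕ (proj₁ (pairAt m i)) < toℕ (proj₂ (pairAt m i))
pairAt-< (suc m) i with splitAt m i
... | inj₁ j = s≤s z≤n
... | inj₂ k = s≤s (pairAt-< m k)

pairAt-injective : ∀ m i j → proj₁ (pairAt m i) ≡ proj₁ (pairAt m j) → proj₂ (pairAt m i) ≡ proj₂ (pairAt m j) → i ≡ j
pairAt-injective (suc m) i j eq₁ eq₂ with splitAt m i in eqᵢ | splitAt m j in eqⱼ
... | inj₁ i′ | inj₁ j′ = trans (sym (splitAt⁻¹-↑ˡ eqᵢ)) (trans (cong (_↑ˡ triangular m) (Finₚ.suc-injective eq₂)) (splitAt⁻¹-↑ˡ eqⱼ))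
... | inj₂ i′ | inj₂ j′ = trans (sym (splitAt⁻¹-↑ʳ {m} eqᵢ)) (trans (cong (m ↑ʳ_)
  (pairAt-injective m i′ j′ (Finₚ.suc-injective eq₁) (Finₚ.suc-injective eq₂))) (splitAt⁻¹-↑ʳ {m} eqⱼ))
... | inj₁ _  | inj₂ _ with () ← eq₁
... | inj₂ _  | inj₁ _ with () ← eq₁

sum-++ : ∀ m {n} (f : Fin (m + n) → ℕ) → sum f ≡ sum (f ∘ (_↑ˡ n)) + sum (f ∘ (m ↑ʳ_))
sum-++ zero        f = cong (_+ sum f) (sym (sum-zero _))
sum-++ (suc m) {n} f = trans (sum-suc f) (trans (cong (f zero +_) (sum-++ m (f ∘ suc)))
  (trans (sym (+-assoc (f zero) _ _)) (cong (_+ sum (f ∘ suc ∘ (m ↑ʳ_))) (sym (sum-suc (f ∘ (_↑ˡ n)))))))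

sum-combine : ∀ m n (f : Fin (m * n) → ℕ) → sum f ≡ sum (λ i → sum (λ j → f (combine {m} {n} i j)))
sum-combine zero    n f = trans (sum-zero f) (sym (sum-zero _))
sum-combine (suc m) n f = trans (sum-++ n f) (trans (cong (sum (f ∘ (_↑ˡ (m * n))) +_) (sum-combine m n (f ∘ (n ↑ʳ_)))) (sym (sum-suc _)))

subset : {P : Fin n → Set} → Decidable P → Subset n
subset P? = tabulate (λ v → does (P? v))

∈-subset⁺ : {P : Fin n → Set} (P? : Decidable P) → ∀ v → P v → v ∈ subset P?
∈-subset⁺ P? v p = lookup⇒[]= v _ (trans (lookup∘tabulate _ v) (dec-true (P? v) p))

∈-subset⁻ : {P : Fin n → Set} (P? : Decidable P) → ∀ v → v ∈ subset P? → P v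
∈-subset⁻ P? v v∈ with P? v | trans (sym (lookup∘tabulate (λ v → does (P? v)) v)) ([]=⇒lookup v∈)
... | yes p | _ = p

∣subset∣ : {P : Fin n → Set} (P? : Decidable P) → ∣ subset P? ∣ ≡ count P?
∣subset∣ P? = trans (sym (count-∈ (subset P?))) (count-cong (_∈? subset P?) P? (∈-subset⁻ P?) (∈-subset⁺ P?))

count-pair : {x y : Fin n} → x ≢ y → count (λ w → (w ≟ x) ⊎-dec (w ≟ y)) ≡ 2
count-pair {x = x} {y} x≢y = trans (sum-cong-≗ pointwise) (trans (∑-distrib-+ (λ w → ⟦ w ≟ x ⟧) (λ w → ⟦ w ≟ y ⟧)) (cong₂ _+_ (count-≟ x) (count-≟ y)))
  where
  pointwise : ∀ w → ⟦ (w ≟ x) ⊎-dec (w ≟ y) ⟧ ≡ ⟦ w ≟ x ⟧ + ⟦ w ≟ y ⟧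
  pointwise w with w ≟ x | w ≟ y
  ... | yes w≡x | yes w≡y = contradiction (trans (sym w≡x) w≡y) x≢y
  ... | yes _   | no _    = refl
  ... | no _    | yes _   = refl
  ... | no _    | no _    = refl

-- A core of c disjoint blocks of size ρ is added to m vertices, and every pair of these
-- is completed by each of the blocks.
module Construction (c ρ m : ℕ) where

  core : ℕ
  core = c * ρ

  block : Fin core → Fin c
  block k = proj₁ (remQuot {c} ρ k)

  InEdge : Fin c → Fin (triangular m) → Fin core ⊎ Fin m → Set
  InEdge i p (inj₁ k) = block k ≡ i
  InEdge i p (inj₂ w) = w ≡ proj₁ (pairAt m p) ⊎ w ≡ proj₂ (pairAt m p)

  inEdge? : ∀ i p → ∀ v → Dec (InEdge i p v)
  inEdge? i p (inj₁ k) = block k ≟ i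
  inEdge? i p (inj₂ w) = (w ≟ proj₁ (pairAt m p)) ⊎-dec (w ≟ proj₂ (pairAt m p))

  edge? : ∀ i p → Decidable (λ v → InEdge i p (splitAt core v))
  edge? i p v = inEdge? i p (splitAt core v)

  label : Fin (c * triangular m) → Fin c
  label e = proj₁ (remQuot {c} (triangular m) e)

  pair : Fin (c * triangular m) → Fin (triangular m)
  pair e = proj₂ (remQuot {c} (triangular m) e)

  H : Fin (c * triangular m) → Subset (core + m)
  H e = subset (edge? (label e) (pair e))

  edge-size : ∀ i p → count (edge? i p) ≡ 2 + ρ
  edge-size i p = trans (sum-++ core (λ v → ⟦ edge? i p v ⟧)) (trans (cong₂ _+_ core-part pair-part) (+-comm ρ 2))
    where
    core-part : sum (λ k → ⟦ edge? i p (k ↑ˡ m) ⟧) ≡ ρ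
    core-part = trans (sum-combine c ρ _) (trans (sum-cong-≗ (λ i′ → trans (sum-cong-≗ (λ j →
        trans (cong (λ s → ⟦ inEdge? i p s ⟧) (splitAt-↑ˡ core (combine i′ j) m))
              (cong (λ q → ⟦ proj₁ q ≟ i ⟧) (remQuot-combine {c} i′ j))))
        (sum-const ρ ⟦ i′ ≟ i ⟧)))
      (trans (sym (*-distribˡ-sum ρ (λ i′ → ⟦ i′ ≟ i ⟧))) (trans (cong (ρ *_) (count-≟ i)) (*-identityʳ ρ))))
    pair-part : sum (λ w → ⟦ edge? i p (core ↑ʳ w) ⟧) ≡ 2
    pair-part = trans (sum-cong-≗ (λ w → cong (λ s → ⟦ inEdge? i p s ⟧) (splitAt-↑ʳ core m w)))
      (count-pair (λ eq → <-irrefl (cong toℕ eq) (pairAt-< m p)))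

  ∈-H⁻ : ∀ e v → v ∈ H e → InEdge (label e) (pair e) (splitAt core v)
  ∈-H⁻ e v = ∈-subset⁻ (edge? (label e) (pair e)) v

  ∈-H-core : ∀ e k → (k ↑ˡ m) ∈ H e → block k ≡ label e
  ∈-H-core e k v∈ = subst (InEdge (label e) (pair e)) (splitAt-↑ˡ core k m) (∈-H⁻ e (k ↑ˡ m) v∈)

  ∈-H-outside : ∀ e w → (core ↑ʳ w) ∈ H e → w ≡ proj₁ (pairAt m (pair e)) ⊎ w ≡ proj₂ (pairAt m (pair e))
  ∈-H-outside e w v∈ = subst (InEdge (label e) (pair e)) (splitAt-↑ʳ core m w) (∈-H⁻ e (core ↑ʳ w) v∈)

  core-∈-H : ∀ e k → block k ≡ label e → (k ↑ˡ m) ∈ H e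
  core-∈-H e k eq = ∈-subset⁺ (edge? (label e) (pair e)) (k ↑ˡ m) (subst (InEdge (label e) (pair e)) (sym (splitAt-↑ˡ core k m)) eq)

  outside-∈-H : ∀ e w → w ≡ proj₁ (pairAt m (pair e)) ⊎ w ≡ proj₂ (pairAt m (pair e)) → (core ↑ʳ w) ∈ H e
  outside-∈-H e w w∈ = ∈-subset⁺ (edge? (label e) (pair e)) (core ↑ʳ w) (subst (InEdge (label e) (pair e)) (sym (splitAt-↑ʳ core m w)) w∈)

  same-edge : ∀ e e′ → label e ≡ label e′ → pair e ≡ pair e′ → e ≡ e′
  same-edge e e′ eqₗ eqₚ = trans (sym (combine-remQuot {c} (triangular m) e)) (trans (cong₂ combine eqₗ eqₚ) (combine-remQuot {c} (triangular m) e′))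

  -- Two distinct vertices occupy both places of a pair, and opposite orders in p and p′ contradict
  -- `pairAt-<`.
  two-outside : ∀ p p′ {w w′} → w ≢ w′ →
    (w ≡ proj₁ (pairAt m p) ⊎ w ≡ proj₂ (pairAt m p)) → (w′ ≡ proj₁ (pairAt m p) ⊎ w′ ≡ proj₂ (pairAt m p)) →
    (w ≡ proj₁ (pairAt m p′) ⊎ w ≡ proj₂ (pairAt m p′)) → (w′ ≡ proj₁ (pairAt m p′) ⊎ w′ ≡ proj₂ (pairAt m p′)) → p ≡ p′
  two-outside p p′ {w} {w′} w≢w′ (inj₁ a) (inj₁ b) _ _ = contradiction (trans a (sym b)) w≢w′
  two-outside p p′ {w} {w′} w≢w′ (inj₂ a) (inj₂ b) _ _ = contradiction (trans a (sym b)) w≢w′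
  two-outside p p′ {w} {w′} w≢w′ _ _ (inj₁ a) (inj₁ b) = contradiction (trans a (sym b)) w≢w′
  two-outside p p′ {w} {w′} w≢w′ _ _ (inj₂ a) (inj₂ b) = contradiction (trans a (sym b)) w≢w′
  two-outside p p′ {w} {w′} w≢w′ (inj₁ a) (inj₂ b) (inj₁ a′) (inj₂ b′) = pairAt-injective m p p′ (trans (sym a) a′) (trans (sym b) b′)
  two-outside p p′ {w} {w′} w≢w′ (inj₂ a) (inj₁ b) (inj₂ a′) (inj₁ b′) = pairAt-injective m p p′ (trans (sym b) b′) (trans (sym a) a′)
  two-outside p p′ {w} {w′} w≢w′ (inj₁ a) (inj₂ b) (inj₂ a′) (inj₁ b′) = contradiction
    (subst₂ _<_ (cong toℕ (trans (sym b′) b)) (cong toℕ (trans (sym a′) a)) (pairAt-< m p′)) (<⇒≯ (pairAt-< m p))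
  two-outside p p′ {w} {w′} w≢w′ (inj₂ a) (inj₁ b) (inj₁ a′) (inj₂ b′) = contradiction
    (subst₂ _<_ (cong toℕ (trans (sym a′) a)) (cong toℕ (trans (sym b′) b)) (pairAt-< m p′)) (<⇒≯ (pairAt-< m p))

  uniform : 1 ≤ ρ → Uniform (2 + ρ) (core + m) (c * triangular m) H
  uniform 1≤ρ = (λ e → trans (∣subset∣ (edge? (label e) (pair e))) (edge-size (label e) (pair e))) , H-injective
    where
    H-injective : Injective _≡_ _≡_ H
    H-injective {e} {e′} eq = same-edge e e′ same-label same-pair
      where
      k : Fin core
      -- A vertex of its block reveals the label of a hyperedge; it exists because the blocks are
      -- nonempty.
      k = combine (label e) (fromℕ< 1≤ρ)
      block-k : block k ≡ label e
      block-k = cong proj₁ (remQuot-combine {c} (label e) (fromℕ< 1≤ρ))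
      same-label : label e ≡ label e′
      same-label = trans (sym block-k) (∈-H-core e′ k (subst ((k ↑ˡ m) ∈_) eq (core-∈-H e k block-k)))
      p₁ p₂ : Fin m
      p₁ = proj₁ (pairAt m (pair e))
      p₂ = proj₂ (pairAt m (pair e))
      same-pair : pair e ≡ pair e′
      same-pair = two-outside (pair e) (pair e′) {p₁} {p₂} (λ p₁≡p₂ → <-irrefl (cong toℕ p₁≡p₂) (pairAt-< m (pair e))) (inj₁ refl) (inj₂ refl)
        (∈-H-outside e′ p₁ (subst ((core ↑ʳ p₁) ∈_) eq (outside-∈-H e p₁ (inj₁ refl))))
        (∈-H-outside e′ p₂ (subst ((core ↑ʳ p₂) ∈_) eq (outside-∈-H e p₂ (inj₂ refl))))

  -- Two vertices outside the core lie in only c common hyperedges, so the core covers all t-heavy edges,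
  -- while each core vertex is the first end of at most one edge of G and the second end of at most one.
  no-heavy-copy : (G : Graph) → (∀ f → proj₁ (ends G f) ≢ proj₂ (ends G f)) →
    Injective _≡_ _≡_ (proj₁ ∘ ends G) → Injective _≡_ _≡_ (proj₂ ∘ ends G) → 2 * core < e G →
    ¬ HeavyIn (suc c) G (core + m) (c * triangular m) H
  no-heavy-copy G loopless first-inj second-inj many (w , w-inj , h , h-inj , joins) = from-collision (pigeonhole many side)
    where
    first second : Fin (e G) → Fin (core + m)
    first f  = w (proj₁ (ends G f))
    second f = w (proj₂ (ends G f))
    InCore : Fin (e G) → Fin 2 × Fin core → Set
    InCore f (zero , k)     = k ↑ˡ m ≡ first f
    InCore f (suc zero , k) = k ↑ˡ m ≡ second f
    outside : ∀ f u v → core ↑ʳ u ≡ first f → core ↑ʳ v ≡ second f → ⊥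
    -- Two of the `suc c` hyperedges have the same block among c, and both contain the pair uv, so
    -- they coincide.
    outside f u v eq₁ eq₂ with pigeonhole (n<1+n c) (λ s → label (h f s))
    ... | s , s′ , s<s′ , same-label = <⇒≢ s<s′ (cong toℕ (h-inj f (same-edge (h f s) (h f s′) same-label
          (two-outside (pair (h f s)) (pair (h f s′)) u≢v (in₁ s) (in₂ s) (in₁ s′) (in₂ s′)))))
      where
      u≢v : u ≢ v
      u≢v eq = loopless f (w-inj (trans (sym eq₁) (trans (cong (core ↑ʳ_) eq) eq₂)))
      in₁ : ∀ s → u ≡ proj₁ (pairAt m (pair (h f s))) ⊎ u ≡ proj₂ (pairAt m (pair (h f s)))
      in₁ s = ∈-H-outside (h f s) u (subst (_∈ H (h f s)) (sym eq₁) (proj₁ (joins f s)))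
      in₂ : ∀ s → v ≡ proj₁ (pairAt m (pair (h f s))) ⊎ v ≡ proj₂ (pairAt m (pair (h f s)))
      in₂ s = ∈-H-outside (h f s) v (subst (_∈ H (h f s)) (sym eq₂) (proj₂ (joins f s)))
    covered : ∀ f → ∃ (InCore f)
    covered f with splitAt core (first f) in eq₁ | splitAt core (second f) in eq₂
    ... | inj₁ k | _      = (zero , k) , splitAt⁻¹-↑ˡ eq₁
    ... | inj₂ _ | inj₁ k = (suc zero , k) , splitAt⁻¹-↑ˡ eq₂
    ... | inj₂ u | inj₂ v = ⊥-elim (outside f u v (splitAt⁻¹-↑ʳ {core} eq₁) (splitAt⁻¹-↑ʳ {core} eq₂))
    -- The code records which end lies in the core and which core vertex it is; there are fewer
    -- codes than edges of `G`.
    side : Fin (e G) → Fin (2 * core)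
    side f = combine (proj₁ (proj₁ (covered f))) (proj₂ (proj₁ (covered f)))
    unique : ∀ {f f′} a → InCore f a → InCore f′ a → f ≡ f′
    unique (zero , k)     p q = first-inj (w-inj (trans (sym p) q))
    unique (suc zero , k) p q = second-inj (w-inj (trans (sym p) q))
    from-collision : ¬ (∃[ f ] ∃[ f′ ] toℕ f < toℕ f′ × side f ≡ side f′)
    from-collision (f , f′ , f<f′ , eq) = <⇒≢ f<f′ (cong toℕ (unique (proj₁ (covered f)) (proj₂ (covered f))
      (subst (InCore f′) (sym (cong₂ _,_ (combine-injectiveˡ (proj₁ (proj₁ (covered f))) _ (proj₁ (proj₁ (covered f′))) _ eq)
                                         (combine-injectiveʳ (proj₁ (proj₁ (covered f))) _ (proj₁ (proj₁ (covered f′))) _ eq)))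
             (proj₂ (covered f′)))))

LowerBound : (r c : ℕ) → ((n M : ℕ) → (Fin M → Subset n) → Set) → Set
LowerBound r c Contains = ∀ d → ∃[ N ] ∀ n → N ≤ n →
  ∃[ M ] Σ (Fin M → Subset n) λ H → Uniform r n M H × ¬ Contains n M H × ((c * suc d ∸ 1) * (n C 2) ≤ suc d * M)

-- `Y` counts the pairs meeting the s core vertices and grows linearly in m, whereas `Z` is
-- quadratic. Once `c * D * Y ≤ Z`, the missing pairs cost at most one copy of `X`, which the
-- subtracted 1 covers.
construction-size : ∀ D c s m → suc (2 * (c * D) * (triangular s + s)) ≤ m →
                    (c * D ∸ 1) * ((s + m) C 2) ≤ D * (c * triangular m)
construction-size D c s (suc m) (s≤s m-large) = begin
  (c * D ∸ 1) * X                                         ≡⟨ *-distribʳ-∸ X (c * D) 1 ⟩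
  c * D * X ∸ 1 * X                                       ≤⟨ m≤n+o⇒m∸n≤o (c * D * X) (1 * X) bound ⟩
  D * (c * triangular (suc m))                            ∎
  where
  open ≤-Reasoning
  X Y Z : ℕ
  X = (s + suc m) C 2
  Y = triangular s + s * suc m
  Z = triangular (suc m)
  X≡ : X ≡ Y + Z
  X≡ = trans (choose₂≡triangular (s + suc m)) (triangular-+ s (suc m))
  small : c * D * Y ≤ Z
  small = *-cancelˡ-≤ 2 (begin
    2 * (c * D * Y)                                       ≤⟨ *-monoʳ-≤ 2 (*-monoʳ-≤ (c * D) (+-monoˡ-≤ (s * suc m) (m≤m*n (triangular s) (suc m)))) ⟩
    2 * (c * D * (triangular s * suc m + s * suc m))      ≡⟨ regroup (c * D) (triangular s) s (suc m) ⟩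
    2 * (c * D) * (triangular s + s) * suc m              ≤⟨ *-monoˡ-≤ (suc m) m-large ⟩
    m * suc m                                             ≡⟨ *-comm m (suc m) ⟩
    suc m * m                                             ≡⟨ 2*choose₂ (suc m) ⟨
    2 * (suc m C 2)                                       ≡⟨ cong (2 *_) (choose₂≡triangular (suc m)) ⟩
    2 * Z                                                 ∎)
    where
    regroup : ∀ a b s m → 2 * (a * (b * m + s * m)) ≡ 2 * a * (b + s) * m
    regroup = solve-∀
  bound : c * D * X ≤ 1 * X + D * (c * Z)
  bound = begin
    c * D * X                      ≡⟨ cong (c * D *_) X≡ ⟩
    c * D * (Y + Z)                ≡⟨ *-distribˡ-+ (c * D) Y Z ⟩
    c * D * Y + c * D * Z          ≤⟨ +-monoˡ-≤ (c * D * Z) (≤-trans small (m≤n+m Z Y)) ⟩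
    (Y + Z) + c * D * Z            ≡⟨ cong₂ _+_ (sym X≡) (regroup c D Z) ⟩
    X + D * (c * Z)                ≡⟨ cong (_+ D * (c * Z)) (*-identityˡ X) ⟨
    1 * X + D * (c * Z)            ∎
    where
    regroup : ∀ c D Z → c * D * Z ≡ D * (c * Z)
    regroup = solve-∀

-- Assembling the asymptotics

heavy-lower-bound : ∀ {c ρ} (G : Graph) → 1 ≤ ρ → (∀ f → proj₁ (ends G f) ≢ proj₂ (ends G f)) →
  Injective _≡_ _≡_ (proj₁ ∘ ends G) → Injective _≡_ _≡_ (proj₂ ∘ ends G) → 2 * (c * ρ) < e G →
  LowerBound (2 + ρ) c (HeavyIn (suc c) G)
heavy-lower-bound {c} {ρ} G 1≤ρ loopless first-inj second-inj many d = N , at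
  where
  s threshold N : ℕ
  s = c * ρ
  threshold = suc (2 * (c * suc d) * (triangular s + s))
  N = s + threshold
  at : ∀ n → N ≤ n → ∃[ M ] Σ (Fin M → Subset n) λ H →
       Uniform (2 + ρ) n M H × ¬ HeavyIn (suc c) G n M H × ((c * suc d ∸ 1) * (n C 2) ≤ suc d * M)
  at n N≤n with m≤n⇒∃[o]m+o≡n (≤-trans (m≤m+n s threshold) N≤n)
  ... | m , refl = c * triangular m , Construction.H c ρ m , Construction.uniform c ρ m 1≤ρ ,
    Construction.no-heavy-copy c ρ m G loopless first-inj second-inj many ,
    construction-size (suc d) c s m (+-cancelˡ-≤ s _ _ N≤n)

LowerBound-mono : ∀ r c {P Q : (n M : ℕ) → (Fin M → Subset n) → Set} →
  (∀ {n M H} → Q n M H → P n M H) → LowerBound r c P → LowerBound r c Q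
LowerBound-mono r c Q⇒P lower d = proj₁ (lower d) , λ n N≤n →
  let M , H , uniform , free , large = proj₂ (lower d) n N≤n in M , H , uniform , free ∘ Q⇒P , large

UpperBound-mono : ∀ r c {P Q : (n M : ℕ) → (Fin M → Subset n) → Set} →
  (∀ {n M H} → P n M H → Q n M H) → UpperBound r c P → UpperBound r c Q
UpperBound-mono r c P⇒Q upper d = proj₁ (upper d) , λ n N≤n M H uniform free → proj₂ (upper d) n N≤n M H uniform (free ∘ P⇒Q)

asymptotics : ∀ r c {P : (n M : ℕ) → (Fin M → Subset n) → Set} → LowerBound r c P → UpperBound r c P → ExAsymp r c P
asymptotics r c lower upper d = proj₁ (lower d) + proj₁ (upper d) , λ n N≤n →
  proj₂ (lower d) n (≤-trans (m≤m+n _ _) N≤n) , proj₂ (upper d) n (≤-trans (m≤n+m _ _) N≤n)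

-- A Berge copy is a heavy copy. Hence a construction without heavy copies and an upper bound for
-- hypergraphs without Berge copies settle both families.
heavy-asymptotics : ∀ r c {t} G → LowerBound r c (HeavyIn t G) → UpperBound r c (BergeIn t G) → ExAsymp r c (HeavyIn t G)
heavy-asymptotics r c {t} G lower upper = asymptotics r c {HeavyIn t G} lower
  (UpperBound-mono r c {BergeIn t G} {HeavyIn t G} (λ {n} {M} {H} → berge⇒heavy {G = G} {H}) upper)

berge-asymptotics : ∀ r c {t} G → LowerBound r c (HeavyIn t G) → UpperBound r c (BergeIn t G) → ExAsymp r c (BergeIn t G)
berge-asymptotics r c {t} G lower upper = asymptotics r c {BergeIn t G}
  (LowerBound-mono r c {HeavyIn t G} {BergeIn t G} (λ {n} {M} {H} → berge⇒heavy {G = G} {H}) lower) upper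

-- For length 3 the bound `2 * (c * ρ) ≤ 2` forces c and ρ to be 1; longer cycles are covered by the
-- general bound.
short-cycle-upper-bound : ∀ {c ρ m} → 1 ≤ c → 1 ≤ ρ → 2 ≤ m → 2 * (c * ρ) ≤ m →
                          UpperBound (2 + ρ) c (BergeIn (suc c) (Cycle (suc m)))
short-cycle-upper-bound {m = suc (suc (suc m))} 1≤c 1≤ρ 2≤m _ =
  cycle-upper-bound (s≤s (s≤s 1≤ρ)) (s≤s 1≤c) (s≤s (s≤s (s≤s z≤n)))
short-cycle-upper-bound {c@(suc _)} {ρ@(suc _)} {suc (suc zero)} 1≤c 1≤ρ _ 2cρ≤2
  with refl ← ≤-antisym (≤-trans (m≤m*n c ρ) (*-cancelˡ-≤ {c * ρ} {1} 2 2cρ≤2)) 1≤c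
     | refl ← ≤-antisym (≤-trans (m≤n*m ρ c) (*-cancelˡ-≤ {c * ρ} {1} 2 2cρ≤2)) 1≤ρ
  = triangle-upper-bound
short-cycle-upper-bound {m = suc zero} _ _ (s≤s ()) _

-- Here `2 + m` is the number k of vertices of the path. Path and cycle both have `suc m` edges,
-- more than the `2 * (c * ρ)` that a heavy copy in the construction allows.
path-and-cycle : ∀ {c ρ m} → 1 ≤ c → 1 ≤ ρ → 2 * (c * ρ) ≤ m →
  ExAsymp (2 + ρ) c (HeavyIn (suc c) (Path (2 + m))) × ExAsymp (2 + ρ) c (BergeIn (suc c) (Path (2 + m))) ×
  ExAsymp (2 + ρ) c (HeavyIn (suc c) (Cycle (1 + m))) × ExAsymp (2 + ρ) c (BergeIn (suc c) (Cycle (1 + m)))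
path-and-cycle {c} {ρ} {m} 1≤c 1≤ρ 2cρ≤m =
  heavy-asymptotics (2 + ρ) c (Path (2 + m)) path-lower path-upper ,
  berge-asymptotics (2 + ρ) c (Path (2 + m)) path-lower path-upper ,
  heavy-asymptotics (2 + ρ) c (Cycle (1 + m)) cycle-lower cycle-upper ,
  berge-asymptotics (2 + ρ) c (Cycle (1 + m)) cycle-lower cycle-upper
  where
  2≤m : 2 ≤ m
  2≤m = ≤-trans (*-monoʳ-≤ 2 (*-mono-≤ 1≤c 1≤ρ)) 2cρ≤m
  path-lower : LowerBound (2 + ρ) c (HeavyIn (suc c) (Path (2 + m)))
  path-lower = heavy-lower-bound (Path (2 + m)) 1≤ρ
    (λ j eq → 1+n≢n (sym (trans (sym (toℕ-inject₁ j)) (cong toℕ eq)))) Finₚ.inject₁-injective Finₚ.suc-injective (s≤s 2cρ≤m)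
  cycle-lower : LowerBound (2 + ρ) c (HeavyIn (suc c) (Cycle (1 + m)))
  cycle-lower = heavy-lower-bound (Cycle (1 + m)) 1≤ρ
    (λ j eq → nextF≢id (<⇒≤ 2≤m) j (sym eq)) id nextF-injective (s≤s 2cρ≤m)
  path-upper : UpperBound (2 + ρ) c (BergeIn (suc c) (Path (2 + m)))
  -- The path is taken from the cycle on the same number of vertices, at least 4, so the triangle
  -- does not arise.
  path-upper = UpperBound-mono (2 + ρ) c {BergeIn (suc c) (Cycle (2 + m))} (λ {n} {M} {H} → berge-path H)
    (cycle-upper-bound (s≤s (s≤s 1≤ρ)) (s≤s 1≤c) (s≤s 2≤m))
  cycle-upper : UpperBound (2 + ρ) c (BergeIn (suc c) (Cycle (1 + m)))
  cycle-upper = short-cycle-upper-bound 1≤c 1≤ρ 2≤m 2cρ≤m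

theorem2 : (r t k : ℕ) → 3 ≤ r → 2 ≤ t → 2 * (t ∸ 1) * (r ∸ 2) + 2 ≤ k →
    ExAsymp r (t ∸ 1) (HeavyIn t (Path k)) × ExAsymp r (t ∸ 1) (BergeIn t (Path k)) ×
    ExAsymp r (t ∸ 1) (HeavyIn t (Cycle (k ∸ 1))) × ExAsymp r (t ∸ 1) (BergeIn t (Cycle (k ∸ 1)))
theorem2 (suc (suc ρ)) (suc c) k (s≤s (s≤s 1≤ρ)) (s≤s 1≤c) k-large
  with k | subst (_≤ k) (+-comm (2 * c * ρ) 2) k-large
... | suc (suc m) | s≤s (s≤s 2cρ≤m) = path-and-cycle 1≤c 1≤ρ (subst (_≤ m) (*-assoc 2 c ρ) 2cρ≤m)
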